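{- Let $\beta\in \mathrm{Sym}_n(\mathbb Q)$ be positive semi-definite of rank $n-1$ and let $\ell\subset V$ be a rational isotropic line. Then there is a finite number of rational $n$-dimensional subspaces $U_1,\dots,U_a$ of $\ell^\perp$ such that $$\{U_1,\dots,U_a\}=\{\mathrm{span}(X):X\in\Omega_{\beta,\ell}\cap(L^n+h)\}.$$
   Context: $V$ is a $\mathbb Q$-vector space of dimension $p+1$ with a non-degenerate symmetric bilinear form $(\,,)$ of signature $(p,1)$, having nonzero rational isotropic vectors; $L\subset V$ is a $\mathbb Z$-lattice of full rank with $L\subset L^{\#}$ (dual lattice); $1\le n\le p$ and $h\in(L^{\#})^n$. For $X=(x_1,\dots,x_n)\in V^n$, $(X,X)$ is the matrix $((x_i,x_j))$ and $R(X)$ is the radical of the subspace $\mathrm{span}(X)$, i.e. $\{u\in\mathrm{span}(X):(u,\mathrm{span}(X))=0\}$. Put $\Omega_{\beta,\ell}=\{X\in V^n:\frac12(X,X)=\beta,\ R(X)=\ell\}$; its elements have entries in $\ell^\perp$. -}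

module Defs where

open import Algebra.Module.Bundles using (Module)
import Algebra.Properties.CommutativeMonoid.Sum as Sum
open import Data.Fin.Base using (Fin; suc; _↑ˡ_; _↑ʳ_)
open import Data.Integer.Base using (ℤ)
open import Data.Nat.Base as ℕ using (ℕ)
open import Data.Product.Base using (∃; ∃-syntax; _×_; _,_)
open import Data.Rational.Base using (ℚ; 0ℚ; ½; _+_; _*_; -_; _/_; _≤_; _<_)
import Data.Rational.Properties as ℚ
open import Data.Vec.Functional using (Vector)
open import Level using (Level; _⊔_; 0ℓ) renaming (suc to lsuc)
open import Relation.Binary.PropositionalEquality using (_≡_; _≢_; refl; cong; cong₂; sym; trans)
open import Relation.Unary using (Pred; _∈_; _⊆_; _≐_; U)

open Sum ℚ.+-0-commutativeMonoid using (sum-syntax)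

ℚ-VectorSpace : (m ℓm : Level) → Set (lsuc (m ⊔ ℓm))
ℚ-VectorSpace = Module ℚ.+-*-commutativeRing

ι : ℤ → ℚ
ι z = z / 1

Integral : Pred ℚ 0ℓ
Integral q = ∃[ z ] q ≡ ι z

module LinearAlgebra {m ℓm : Level} (V : ℚ-VectorSpace m ℓm) where

  open Module V
  private
    module Σᴹ = Sum +ᴹ-commutativeMonoid

  linComb : ∀ {d} → Vector ℚ d → Vector Carrierᴹ d → Carrierᴹ
  linComb c x = Σᴹ.sum (λ i → c i *ₗ x i)

  Span : ∀ {d} → Vector Carrierᴹ d → Pred Carrierᴹ ℓm
  Span {d} x u = ∃ λ (c : Vector ℚ d) → u ≈ᴹ linComb c x

  ℤSpan : ∀ {d} → Vector Carrierᴹ d → Pred Carrierᴹ ℓm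
  ℤSpan {d} x u = ∃ λ (c : Vector ℤ d) → u ≈ᴹ linComb (λ i → ι (c i)) x

  LinearlyIndependent : ∀ {d} → Vector Carrierᴹ d → Set ℓm
  LinearlyIndependent x = ∀ c → linComb c x ≈ᴹ 0ᴹ → ∀ i → c i ≡ 0ℚ

  IsBasisOf : ∀ {s d} → Pred Carrierᴹ s → Vector Carrierᴹ d → Set (m ⊔ ℓm ⊔ s)
  IsBasisOf W x = LinearlyIndependent x × W ≐ Span x

  HasDimension : ∀ {s} → Pred Carrierᴹ s → ℕ → Set (m ⊔ ℓm ⊔ s)
  HasDimension W d = ∃ λ (x : Vector Carrierᴹ d) → IsBasisOf W x

  record Subspace (s : Level) : Set (m ⊔ ℓm ⊔ lsuc s) where
    field
      member   : Pred Carrierᴹ s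
      resp-≈   : ∀ {u v} → u ≈ᴹ v → u ∈ member → v ∈ member
      0-closed : 0ᴹ ∈ member
      +-closed : ∀ {u v} → u ∈ member → v ∈ member → (u +ᴹ v) ∈ member
      *-closed : ∀ {u} q → u ∈ member → (q *ₗ u) ∈ member

  open Subspace public using (member)

  private
    *ₗ-distribˡ-sum : ∀ {d} q (x : Vector Carrierᴹ d) →
                      q *ₗ Σᴹ.sum x ≈ᴹ Σᴹ.sum (λ i → q *ₗ x i)
    *ₗ-distribˡ-sum {ℕ.zero}  q x = *ₗ-zeroʳ q
    *ₗ-distribˡ-sum {ℕ.suc d} q x = ≈ᴹ-trans (*ₗ-distribˡ q _ _)
      (+ᴹ-cong ≈ᴹ-refl (*ₗ-distribˡ-sum q (λ i → x (suc i))))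

    linComb-0 : ∀ {d} (x : Vector Carrierᴹ d) → linComb (λ _ → 0ℚ) x ≈ᴹ 0ᴹ
    linComb-0 {d} x = ≈ᴹ-trans (Σᴹ.sum-cong-≋ (λ i → *ₗ-zeroˡ (x i))) (Σᴹ.sum-replicate-zero d)

    linComb-+ : ∀ {d} b c (x : Vector Carrierᴹ d) →
                linComb (λ i → b i + c i) x ≈ᴹ linComb b x +ᴹ linComb c x
    linComb-+ b c x = ≈ᴹ-trans (Σᴹ.sum-cong-≋ (λ i → *ₗ-distribʳ (x i) (b i) (c i)))
      (Σᴹ.∑-distrib-+ (λ i → b i *ₗ x i) (λ i → c i *ₗ x i))

    linComb-* : ∀ {d} q c (x : Vector Carrierᴹ d) →
                linComb (λ i → q * c i) x ≈ᴹ q *ₗ linComb c x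
    linComb-* q c x = ≈ᴹ-trans (Σᴹ.sum-cong-≋ (λ i → *ₗ-assoc q (c i) (x i)))
      (≈ᴹ-sym (*ₗ-distribˡ-sum q (λ i → c i *ₗ x i)))

  span : ∀ {d} → Vector Carrierᴹ d → Subspace ℓm
  span x = record
    { member   = Span x
    ; resp-≈   = λ { u≈v (c , u≈) → c , ≈ᴹ-trans (≈ᴹ-sym u≈v) u≈ }
    ; 0-closed = (λ _ → 0ℚ) , ≈ᴹ-sym (linComb-0 x)
    ; +-closed = λ { (b , u≈) (c , v≈) →
        (λ i → b i + c i) , ≈ᴹ-trans (+ᴹ-cong u≈ v≈) (≈ᴹ-sym (linComb-+ b c x)) }
    ; *-closed = λ { q (c , u≈) →
        (λ i → q * c i) , ≈ᴹ-trans (*ₗ-cong refl u≈) (≈ᴹ-sym (linComb-* q c x)) }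
    }

  -- The set of subspaces { F i : i ∈ P }; equality of subspaces is having
  -- the same elements.
  SetOf : ∀ {i p s} {I : Set i} → Pred I p → (I → Subspace s) → Pred (Subspace s) (i ⊔ p ⊔ m ⊔ s)
  SetOf P F W = ∃ λ i → i ∈ P × member W ≐ member (F i)

  -- Full-rank ℤ-lattices in a d-dimensional V: ℤ-spans of ℚ-bases of V.
  IsFullLattice : ∀ {s} → ℕ → Pred Carrierᴹ s → Set (m ⊔ ℓm ⊔ s)
  IsFullLattice d L = ∃ λ (b : Vector Carrierᴹ d) → IsBasisOf U b × L ≐ ℤSpan b

  -- Lⁿ + h
  Coset : ∀ {s n} → Pred Carrierᴹ s → Vector Carrierᴹ n → Pred (Vector Carrierᴹ n) (m ⊔ ℓm ⊔ s)
  Coset L h X = ∀ i → ∃ λ x → x ∈ L × X i ≈ᴹ x +ᴹ h i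

ℚ^ : ℕ → ℚ-VectorSpace 0ℓ 0ℓ
ℚ^ n = record
  { Carrierᴹ = Vector ℚ n
  ; _≈ᴹ_     = λ x y → ∀ i → x i ≡ y i
  ; _+ᴹ_     = λ x y i → x i + y i
  ; _*ₗ_     = λ q x i → q * x i
  ; _*ᵣ_     = λ x q i → x i * q
  ; 0ᴹ       = λ _ → 0ℚ
  ; -ᴹ_      = λ x i → - x i
  ; isModule = record
    { isBimodule = record
      { isBisemimodule = record
        { +ᴹ-isCommutativeMonoid = record
          { isMonoid = record
            { isSemigroup = record
              { isMagma = record
                { isEquivalence = record
                  { refl  = λ _ → refl
                  ; sym   = λ p i → sym (p i)
                  ; trans = λ p q i → trans (p i) (q i)
                  }
                ; ∙-cong = λ p q i → cong₂ _+_ (p i) (q i)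
                }
              ; assoc = λ x y z i → ℚ.+-assoc (x i) (y i) (z i)
              }
            ; identity = (λ x i → ℚ.+-identityˡ (x i)) , (λ x i → ℚ.+-identityʳ (x i))
            }
          ; comm = λ x y i → ℚ.+-comm (x i) (y i)
          }
        ; isPreleftSemimodule = record
          { *ₗ-cong      = λ p q i → cong₂ _*_ p (q i)
          ; *ₗ-zeroˡ     = λ x i → ℚ.*-zeroˡ (x i)
          ; *ₗ-distribʳ  = λ x q r i → ℚ.*-distribʳ-+ (x i) q r
          ; *ₗ-identityˡ = λ x i → ℚ.*-identityˡ (x i)
          ; *ₗ-assoc     = λ q r x i → ℚ.*-assoc q r (x i)
          ; *ₗ-zeroʳ     = λ q i → ℚ.*-zeroʳ q
          ; *ₗ-distribˡ  = λ q x y i → ℚ.*-distribˡ-+ q (x i) (y i)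
          }
        ; isPrerightSemimodule = record
          { *ᵣ-cong      = λ q p i → cong₂ _*_ (q i) p
          ; *ᵣ-zeroʳ     = λ x i → ℚ.*-zeroʳ (x i)
          ; *ᵣ-distribˡ  = λ x q r i → ℚ.*-distribˡ-+ (x i) q r
          ; *ᵣ-identityʳ = λ x i → ℚ.*-identityʳ (x i)
          ; *ᵣ-assoc     = λ x q r i → ℚ.*-assoc (x i) q r
          ; *ᵣ-zeroˡ     = λ q i → ℚ.*-zeroˡ q
          ; *ᵣ-distribʳ  = λ q x y i → ℚ.*-distribʳ-+ q (x i) (y i)
          }
        ; *ₗ-*ᵣ-assoc = λ q x r i → ℚ.*-assoc q (x i) r
        }
      ; -ᴹ‿cong    = λ p i → cong -_ (p i)
      ; -ᴹ‿inverse = (λ x i → ℚ.+-inverseˡ (x i)) , (λ x i → ℚ.+-inverseʳ (x i))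
      }
    ; *ₗ-*ᵣ-coincident = λ q x i → ℚ.*-comm q (x i)
    }
  }

Matrix : ℕ → Set
Matrix n = Vector (Vector ℚ n) n

IsSymmetric : ∀ {n} → Matrix n → Set
IsSymmetric β = ∀ i j → β i j ≡ β j i

PositiveSemidefinite : ∀ {n} → Matrix n → Set
PositiveSemidefinite {n} β =
  ∀ (c : Vector ℚ n) → 0ℚ ≤ ∑[ i < n ] ∑[ j < n ] (c i * β i j * c j)

HasRank : ∀ {n} → Matrix n → ℕ → Set
HasRank {n} β r = HasDimension (Span β) r
  where open LinearAlgebra (ℚ^ n)

record SymmetricBilinearForm {m ℓm : Level} (V : ℚ-VectorSpace m ℓm) : Set (m ⊔ ℓm) where
  open Module V
  field
    ⟨_,_⟩   : Carrierᴹ → Carrierᴹ → ℚ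
    ⟨⟩-cong : ∀ {u u′ v v′} → u ≈ᴹ u′ → v ≈ᴹ v′ → ⟨ u , v ⟩ ≡ ⟨ u′ , v′ ⟩
    ⟨⟩-sym  : ∀ u v → ⟨ u , v ⟩ ≡ ⟨ v , u ⟩
    ⟨⟩-+    : ∀ u v w → ⟨ u +ᴹ v , w ⟩ ≡ ⟨ u , w ⟩ + ⟨ v , w ⟩
    ⟨⟩-*    : ∀ q u w → ⟨ q *ₗ u , w ⟩ ≡ q * ⟨ u , w ⟩

module QuadraticSpace {m ℓm : Level} {V : ℚ-VectorSpace m ℓm} (B : SymmetricBilinearForm V) where

  open Module V
  open LinearAlgebra V
  open SymmetricBilinearForm B

  NonDegenerate : Set (m ⊔ ℓm)
  NonDegenerate = ∀ u → (∀ v → ⟨ u , v ⟩ ≡ 0ℚ) → u ≈ᴹ 0ᴹ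

  -- Some orthogonal basis has p vectors of positive norm and q of negative
  -- norm.  (By Sylvester's law of inertia p and q do not depend on the basis.)
  HasSignature : ℕ → ℕ → Set (m ⊔ ℓm)
  HasSignature p q = ∃ λ (e : Vector Carrierᴹ (p ℕ.+ q)) →
    IsBasisOf U e
    × (∀ i j → i ≢ j → ⟨ e i , e j ⟩ ≡ 0ℚ)
    × (∀ (i : Fin p) → 0ℚ < ⟨ e (i ↑ˡ q) , e (i ↑ˡ q) ⟩)
    × (∀ (j : Fin q) → ⟨ e (p ↑ʳ j) , e (p ↑ʳ j) ⟩ < 0ℚ)

  Isotropic : Pred Carrierᴹ 0ℓ
  Isotropic u = ⟨ u , u ⟩ ≡ 0ℚ

  IsIsotropicLine : ∀ {s} → Subspace s → Set (m ⊔ ℓm ⊔ s)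
  IsIsotropicLine ℓ = HasDimension (member ℓ) 1 × member ℓ ⊆ Isotropic

  _♯ : ∀ {s} → Pred Carrierᴹ s → Pred Carrierᴹ (m ⊔ s)
  (L ♯) u = ∀ x → x ∈ L → Integral ⟨ u , x ⟩

  _⊥ : ∀ {s} → Subspace s → Pred Carrierᴹ (m ⊔ s)
  (W ⊥) u = ∀ w → w ∈ member W → ⟨ u , w ⟩ ≡ 0ℚ

  Radical : ∀ {s} → Subspace s → Pred Carrierᴹ (m ⊔ s)
  Radical W u = u ∈ member W × u ∈ (W ⊥)

  Ω : ∀ {n s} → Matrix n → Subspace s → Pred (Vector Carrierᴹ n) (m ⊔ ℓm ⊔ s)
  Ω β ℓ X = (∀ i j → ½ * ⟨ X i , X j ⟩ ≡ β i j) × Radical (span X) ≐ member ℓ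

{-# OPTIONS --safe #-}

-- Let w ∈ L span ℓ and let e be an orthogonal basis whose last vector is the
-- negative one.  A vector y ⊥ w is congruent modulo ℚw to a vector with
-- vanishing last e-coordinate, on which the form is a positive diagonal one;
-- so a bound on (y,y) bounds y modulo ℚw, and after subtracting an integral
-- multiple of w it bounds y itself.  Hence the entries of
-- X ∈ Ω_{β,ℓ} ∩ (Lⁿ + h) lie in finitely many classes modulo ℤw, and
-- span(X) ⊇ ℓ depends only on these classes.  Conversely a tuple in Lⁿ + h
-- that is orthogonal to w and has Gram matrix 2β lies in Ω_{β,ℓ} after
-- shifting one entry by w if necessary, so the classes that occur can be
-- decided.  The span has dimension n because ker β is one-dimensional and its
-- generator c gives Σ cᵢ Xᵢ ∈ ℓ ∖ 0.

module Submission where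

open import Defs
open import Algebra.Bundles using (CommutativeRing)
open import Algebra.Module.Bundles using (Module)
import Algebra.Properties.CommutativeMonoid.Sum as Sum
import Algebra.Properties.Semiring.Sum as SemiringSum
open import Data.Fin.Base as Fin using (Fin; zero; suc; punchIn; punchOut; _↑ʳ_)
import Data.Fin.Properties as Fin
open import Data.Integer.Base as ℤ using (ℤ; 0ℤ; 1ℤ)
import Data.Integer.DivMod as ℤ
import Data.Integer.Properties as ℤ
open import Data.List.Base as List using (List; []; upTo)
import Data.List.Membership.Propositional as List
open import Data.List.Membership.Propositional.Properties using (∈-map⁺; ∈-upTo⁺; ∈-cartesianProductWith⁺)
open import Data.List.Relation.Unary.Any using (here; there; index)
open import Data.List.Relation.Unary.Any.Properties using (lookup-index)
open import Data.Nat.Base as ℕ using (ℕ; zero; suc; _∸_)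
import Data.Nat.Properties as ℕ
open import Data.Product.Base using (∃; ∃₂; _×_; _,_; proj₁; proj₂)
open import Data.Rational.Base as ℚ using (ℚ; 0ℚ; 1ℚ; ½; _+_; _*_; -_; _-_; _≤_; _<_; ∣_∣; 1/_; ↥_; ↧_; ↧ₙ_)
import Data.Rational.Properties as ℚ
open import Data.Rational.Solver using (module +-*-Solver)
open import Data.Rational.Unnormalised.Base as ℚᵘ using (mkℚᵘ; *≤*; *≡*)
import Data.Rational.Unnormalised.Properties as ℚᵘ
open import Data.Sum.Base using (_⊎_; inj₁; inj₂)
open import Data.Unit.Base using (tt)
open import Data.Vec.Functional using (Vector; _∷_)
open import Function.Base using (_∘_)
open import Level using (Level; _⊔_)
open import Relation.Binary.PropositionalEquality using (_≡_; _≢_; _≗_; refl; sym; trans; cong; cong₂; subst; module ≡-Reasoning)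
open import Relation.Nullary.Decidable using (Dec; yes; no; _×-dec_)
open import Relation.Nullary.Negation using (¬_; contradiction)
open import Relation.Unary using (Pred; _∈_; _⊆_; _≐_; _∩_; U)

open +-*-Solver using (solve; _:+_; _:*_; :-_; _:-_; _:=_; con)
open SemiringSum (CommutativeRing.semiring ℚ.+-*-commutativeRing)
  using (sum; sum-cong-≗; ∑-distrib-+; *-distribˡ-sum; *-distribʳ-sum; sum-replicate-zero; sum-remove)

-- Integers inside the rationals

toℚᵘ-ι : ∀ z → ℚ.toℚᵘ (ι z) ℚᵘ.≃ mkℚᵘ z 0
toℚᵘ-ι z = ℚ.toℚᵘ-fromℚᵘ (mkℚᵘ z 0)

ι-+ : ∀ a b → ι (a ℤ.+ b) ≡ ι a + ι b
ι-+ a b = ℚ.toℚᵘ-injective (begin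
  ℚ.toℚᵘ (ι (a ℤ.+ b))               ≈⟨ toℚᵘ-ι (a ℤ.+ b) ⟩
  mkℚᵘ (a ℤ.+ b) 0                   ≈⟨ *≡* (cong (ℤ._* ℤ.+ 1) (cong₂ ℤ._+_ (sym (ℤ.*-identityʳ a)) (sym (ℤ.*-identityʳ b)))) ⟩
  mkℚᵘ a 0 ℚᵘ.+ mkℚᵘ b 0             ≈⟨ ℚᵘ.+-cong (toℚᵘ-ι a) (toℚᵘ-ι b) ⟨
  ℚ.toℚᵘ (ι a) ℚᵘ.+ ℚ.toℚᵘ (ι b)     ≈⟨ ℚ.toℚᵘ-homo-+ (ι a) (ι b) ⟨
  ℚ.toℚᵘ (ι a + ι b)                 ∎)
  where open ℚᵘ.≃-Reasoning

ι-* : ∀ a b → ι (a ℤ.* b) ≡ ι a * ι b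
ι-* a b = ℚ.toℚᵘ-injective (begin
  ℚ.toℚᵘ (ι (a ℤ.* b))               ≈⟨ toℚᵘ-ι (a ℤ.* b) ⟩
  mkℚᵘ a 0 ℚᵘ.* mkℚᵘ b 0             ≈⟨ ℚᵘ.*-cong (toℚᵘ-ι a) (toℚᵘ-ι b) ⟨
  ℚ.toℚᵘ (ι a) ℚᵘ.* ℚ.toℚᵘ (ι b)     ≈⟨ ℚ.toℚᵘ-homo-* (ι a) (ι b) ⟨
  ℚ.toℚᵘ (ι a * ι b)                 ∎)
  where open ℚᵘ.≃-Reasoning

ι-neg : ∀ a → ι (ℤ.- a) ≡ - ι a
ι-neg a = begin
  ι (ℤ.- a)                  ≡⟨ solve 2 (λ x y → x := (y :+ x) :- y) refl (ι (ℤ.- a)) (ι a) ⟩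
  ι a + ι (ℤ.- a) - ι a      ≡⟨ cong (_- ι a) (ι-+ a (ℤ.- a)) ⟨
  ι (a ℤ.+ ℤ.- a) - ι a      ≡⟨ cong (λ z → ι z - ι a) (ℤ.+-inverseʳ a) ⟩
  0ℚ - ι a                   ≡⟨ ℚ.+-identityˡ (- ι a) ⟩
  - ι a                      ∎
  where open ≡-Reasoning

ι-cancel-≤ : ∀ {a b} → ι a ≤ ι b → a ℤ.≤ b
ι-cancel-≤ {a} {b} a≤b with ℚᵘ.≤-respˡ-≃ (toℚᵘ-ι a) (ℚᵘ.≤-respʳ-≃ (toℚᵘ-ι b) (ℚ.toℚᵘ-mono-≤ a≤b))
... | *≤* a*1≤b*1 = ℤ.*-cancelʳ-≤-pos a b (ℤ.+ 1) a*1≤b*1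

ι-injective : ∀ {a b} → ι a ≡ ι b → a ≡ b
ι-injective eq = ℤ.≤-antisym (ι-cancel-≤ (ℚ.≤-reflexive eq)) (ι-cancel-≤ (ℚ.≤-reflexive (sym eq)))

ι-↧* : ∀ q → ι (↧ q) * q ≡ ι (↥ q)
ι-↧* q@record{} = ℚ.toℚᵘ-injective (begin
  ℚ.toℚᵘ (ι (↧ q) * q)               ≈⟨ ℚ.toℚᵘ-homo-* (ι (↧ q)) q ⟩
  ℚ.toℚᵘ (ι (↧ q)) ℚᵘ.* ℚ.toℚᵘ q     ≈⟨ ℚᵘ.*-cong {v = ℚ.toℚᵘ q} (toℚᵘ-ι (↧ q)) ℚᵘ.≃-refl ⟩
  mkℚᵘ (↧ q) 0 ℚᵘ.* ℚ.toℚᵘ q         ≈⟨ *≡* (lemma q) ⟩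
  mkℚᵘ (↥ q) 0                       ≈⟨ toℚᵘ-ι (↥ q) ⟨
  ℚ.toℚᵘ (ι (↥ q))                   ∎)
  where
  open ℚᵘ.≃-Reasoning
  lemma : ∀ q → ↧ q ℤ.* ↥ q ℤ.* ℤ.+ 1 ≡ ↥ q ℤ.* ℤ.+ (1 ℕ.* ↧ₙ q)
  lemma q = trans (ℤ.*-identityʳ (↧ q ℤ.* ↥ q))
    (trans (ℤ.*-comm (↧ q) (↥ q)) (cong (λ k → ↥ q ℤ.* ℤ.+ k) (sym (ℕ.*-identityˡ (↧ₙ q)))))

-- The quotient `↥ q ℤ./ℕ ↧ₙ q` is the floor of `q`. This bound and the next one are division with
-- remainder, read with the denominator cleared.
ι⌊q⌋≤q : ∀ q → ι (↥ q ℤ./ℕ ↧ₙ q) ≤ q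
ι⌊q⌋≤q q@record{} = ℚ.toℚᵘ-cancel-≤ (ℚᵘ.≤-respˡ-≃ (ℚᵘ.≃-sym (toℚᵘ-ι (↥ q ℤ./ℕ ↧ₙ q)))
  (*≤* (subst ((↥ q ℤ./ℕ ↧ₙ q) ℤ.* ↧ q ℤ.≤_) (sym (ℤ.*-identityʳ (↥ q))) (ℤ.[n/ℕd]*d≤n (↥ q) (↧ₙ q)))))

q≤ι[1+⌊q⌋] : ∀ q → q ≤ ι (ℤ.suc (↥ q ℤ./ℕ ↧ₙ q))
q≤ι[1+⌊q⌋] q@record{} = ℚ.toℚᵘ-cancel-≤ (ℚᵘ.≤-respʳ-≃ (ℚᵘ.≃-sym (toℚᵘ-ι (ℤ.suc (↥ q ℤ./ℕ ↧ₙ q))))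
  (*≤* (subst (ℤ._≤ ℤ.suc (↥ q ℤ./ℕ ↧ₙ q) ℤ.* ↧ q) (sym (ℤ.*-identityʳ (↥ q)))
    (ℤ.<⇒≤ (ℤ.n<s[n/ℕd]*d (↥ q) (↧ₙ q))))))

near-integer : ∀ q → ∃ λ k → ∣ q - ι k ∣ ≤ 1ℚ
near-integer q = k , ℚ.≤-trans (ℚ.≤-reflexive (ℚ.0≤p⇒∣p∣≡p 0≤q-k)) q-k≤1
  where
  k = ↥ q ℤ./ℕ ↧ₙ q
  0≤q-k : 0ℚ ≤ q - ι k
  0≤q-k = subst (_≤ q - ι k) (ℚ.+-inverseʳ (ι k)) (ℚ.+-monoˡ-≤ (- ι k) (ι⌊q⌋≤q q))
  q-k≤1 : q - ι k ≤ 1ℚ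
  q-k≤1 = subst (q - ι k ≤_)
    (trans (cong (_- ι k) (ι-+ 1ℤ k)) (solve 2 (λ x y → (x :+ y) :- y := x) refl 1ℚ (ι k)))
    (ℚ.+-monoˡ-≤ (- ι k) (q≤ι[1+⌊q⌋] q))

p≤∣p∣ : ∀ p → p ≤ ∣ p ∣
p≤∣p∣ p with ℚ.≤-total 0ℚ p
... | inj₁ 0≤p = ℚ.≤-reflexive (sym (ℚ.0≤p⇒∣p∣≡p 0≤p))
... | inj₂ p≤0 = ℚ.≤-trans p≤0 (ℚ.0≤∣p∣ p)

-p≤∣p∣ : ∀ p → - p ≤ ∣ p ∣
-p≤∣p∣ p = subst (- p ≤_) (ℚ.∣-p∣≡∣p∣ p) (p≤∣p∣ (- p))

-- The list is the interval from -M to M with M = ⌊K⌋ + 1, and `z` stands at position M + z. If M is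
-- negative no `z` meets the bound, so the absolute value in the length does no harm.
bounded-integers : ∀ K → ∃ λ (zs : List ℤ) → ∀ z → ∣ ι z ∣ ≤ K → z List.∈ zs
bounded-integers K = List.map (λ k → ℤ.- M ℤ.+ ℤ.+ k) (upTo (suc ℤ.∣ M ℤ.+ M ∣)) , complete
  where
  M = ℤ.suc (↥ K ℤ./ℕ ↧ₙ K)
  complete : ∀ z → ∣ ι z ∣ ≤ K → z List.∈ List.map (λ k → ℤ.- M ℤ.+ ℤ.+ k) (upTo (suc ℤ.∣ M ℤ.+ M ∣))
  complete z ∣z∣≤K = subst (List._∈ _) shift (∈-map⁺ (λ k → ℤ.- M ℤ.+ ℤ.+ k) (∈-upTo⁺ (ℕ.s≤s (ℤ.drop‿+≤+ (begin
    ℤ.+ ℤ.∣ M ℤ.+ z ∣  ≡⟨ ℤ.0≤i⇒+∣i∣≡i 0≤M+z ⟩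
    M ℤ.+ z          ≤⟨ ℤ.+-monoʳ-≤ M z≤M ⟩
    M ℤ.+ M          ≡⟨ ℤ.0≤i⇒+∣i∣≡i (ℤ.≤-trans 0≤M+z (ℤ.+-monoʳ-≤ M z≤M)) ⟨
    ℤ.+ ℤ.∣ M ℤ.+ M ∣  ∎)))))
    where
    open ℤ.≤-Reasoning
    z≤M : z ℤ.≤ M
    z≤M = ι-cancel-≤ (ℚ.≤-trans (p≤∣p∣ (ι z)) (ℚ.≤-trans ∣z∣≤K (q≤ι[1+⌊q⌋] K)))
    -z≤M : ℤ.- z ℤ.≤ M
    -z≤M = ι-cancel-≤ (subst (_≤ ι M) (sym (ι-neg z))
      (ℚ.≤-trans (-p≤∣p∣ (ι z)) (ℚ.≤-trans ∣z∣≤K (q≤ι[1+⌊q⌋] K))))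
    0≤M+z : 0ℤ ℤ.≤ M ℤ.+ z
    0≤M+z = subst (ℤ._≤ M ℤ.+ z) (ℤ.+-inverseˡ z) (ℤ.+-monoˡ-≤ z -z≤M)
    shift : ℤ.- M ℤ.+ ℤ.+ ℤ.∣ M ℤ.+ z ∣ ≡ z
    shift = trans (cong (λ k → ℤ.- M ℤ.+ k) (ℤ.0≤i⇒+∣i∣≡i 0≤M+z))
      (trans (sym (ℤ.+-assoc (ℤ.- M) M z)) (trans (cong (ℤ._+ z) (ℤ.+-inverseˡ M)) (ℤ.+-identityˡ z)))

-- `D` is the product of all denominators, built up entry by entry.
common-denominator : ∀ {d} (c : Vector ℚ d) →
  ∃₂ λ (D : ℤ) (C : Vector ℤ d) → ι D ≢ 0ℚ × ∀ j → ι D * c j ≡ ι (C j)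
common-denominator {zero} c = 1ℤ , (λ ()) , (λ ()) , λ ()
common-denominator {suc d} c with common-denominator (λ j → c (suc j))
... | D , C , D≢0 , eq = ↧ c zero ℤ.* D , (D ℤ.* ↥ c zero ∷ λ j → ↧ c zero ℤ.* C j) , nonzero , λ where
    zero → begin
      ι (↧ c zero ℤ.* D) * c zero        ≡⟨ cong (_* c zero) (ι-* (↧ c zero) D) ⟩
      ι (↧ c zero) * ι D * c zero        ≡⟨ solve 3 (λ x y z → x :* y :* z := y :* (x :* z)) refl (ι (↧ c zero)) (ι D) (c zero) ⟩
      ι D * (ι (↧ c zero) * c zero)      ≡⟨ cong (ι D *_) (ι-↧* (c zero)) ⟩
      ι D * ι (↥ c zero)                 ≡⟨ ι-* D (↥ c zero) ⟨
      ι (D ℤ.* ↥ c zero)                 ∎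
    (suc j) → begin
      ι (↧ c zero ℤ.* D) * c (suc j)     ≡⟨ cong (_* c (suc j)) (ι-* (↧ c zero) D) ⟩
      ι (↧ c zero) * ι D * c (suc j)     ≡⟨ ℚ.*-assoc (ι (↧ c zero)) (ι D) (c (suc j)) ⟩
      ι (↧ c zero) * (ι D * c (suc j))   ≡⟨ cong (ι (↧ c zero) *_) (eq j) ⟩
      ι (↧ c zero) * ι (C j)             ≡⟨ ι-* (↧ c zero) (C j) ⟨
      ι (↧ c zero ℤ.* C j)               ∎
  where
  open ≡-Reasoning
  nonzero : ι (↧ c zero ℤ.* D) ≢ 0ℚ
  -- The denominator of a rational is positive, so only the second factor can vanish.
  nonzero eq₀ with ℤ.i*j≡0⇒i≡0∨j≡0 (↧ c zero) {D} (ι-injective {b = 0ℤ} eq₀)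
  ... | inj₂ D≡0 = D≢0 (cong ι D≡0)

-- Products and squares

p*q≡0⇒p≡0∨q≡0 : ∀ p q → p * q ≡ 0ℚ → p ≡ 0ℚ ⊎ q ≡ 0ℚ
p*q≡0⇒p≡0∨q≡0 p q pq≡0 with p ℚ.≟ 0ℚ
... | yes p≡0 = inj₁ p≡0
... | no p≢0 = inj₂ (begin
    q              ≡⟨ ℚ.*-identityˡ q ⟨
    1ℚ * q         ≡⟨ cong (_* q) (ℚ.*-inverseˡ p) ⟨
    1/ p * p * q   ≡⟨ ℚ.*-assoc (1/ p) p q ⟩
    1/ p * (p * q) ≡⟨ cong (1/ p *_) pq≡0 ⟩
    1/ p * 0ℚ      ≡⟨ ℚ.*-zeroʳ (1/ p) ⟩
    0ℚ             ∎)
  where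
  open ≡-Reasoning
  instance _ = ℚ.≢-nonZero p≢0

p≢0∧p*q≡0⇒q≡0 : ∀ {p q} → p ≢ 0ℚ → p * q ≡ 0ℚ → q ≡ 0ℚ
p≢0∧p*q≡0⇒q≡0 {p} {q} p≢0 pq≡0 with p*q≡0⇒p≡0∨q≡0 p q pq≡0
... | inj₁ p≡0 = contradiction p≡0 p≢0
... | inj₂ q≡0 = q≡0

p*p≡0⇒p≡0 : ∀ p → p * p ≡ 0ℚ → p ≡ 0ℚ
p*p≡0⇒p≡0 p pp≡0 with p*q≡0⇒p≡0∨q≡0 p p pp≡0
... | inj₁ p≡0 = p≡0
... | inj₂ p≡0 = p≡0

0≤p*q : ∀ {p q} → 0ℚ ≤ p → 0ℚ ≤ q → 0ℚ ≤ p * q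
0≤p*q {p} {q} 0≤p 0≤q = subst (_≤ p * q) (ℚ.*-zeroʳ p)
  (ℚ.*-monoˡ-≤-nonNeg p {{ℚ.nonNegative 0≤p}} 0≤q)

∣p∣*∣p∣≡p*p : ∀ p → ∣ p ∣ * ∣ p ∣ ≡ p * p
∣p∣*∣p∣≡p*p p with ℚ.∣p∣≡p∨∣p∣≡-p p
... | inj₁ eq rewrite eq = refl
... | inj₂ eq rewrite eq = solve 1 (λ x → (:- x) :* (:- x) := x :* x) refl p

0≤p*p : ∀ p → 0ℚ ≤ p * p
0≤p*p p = subst (0ℚ ≤_) (∣p∣*∣p∣≡p*p p) (0≤p*q (ℚ.0≤∣p∣ p) (ℚ.0≤∣p∣ p))

-- Stands in for a square root: a bound on a square gives a rational bound on the absolute value. If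
-- 1 ≤ |p| then already |p| ≤ p².
∣p∣≤1+p*p : ∀ p → ∣ p ∣ ≤ 1ℚ + p * p
∣p∣≤1+p*p p with ℚ.≤-total ∣ p ∣ 1ℚ
... | inj₁ ∣p∣≤1 = ℚ.≤-trans ∣p∣≤1 (subst (_≤ 1ℚ + p * p) (ℚ.+-identityʳ 1ℚ) (ℚ.+-monoʳ-≤ 1ℚ (0≤p*p p)))
... | inj₂ 1≤∣p∣ = begin
    ∣ p ∣           ≡⟨ ℚ.*-identityʳ ∣ p ∣ ⟨
    ∣ p ∣ * 1ℚ      ≤⟨ ℚ.*-monoˡ-≤-nonNeg ∣ p ∣ {{ℚ.∣-∣-nonNeg p}} 1≤∣p∣ ⟩
    ∣ p ∣ * ∣ p ∣   ≡⟨ ∣p∣*∣p∣≡p*p p ⟩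
    p * p           ≡⟨ ℚ.+-identityˡ (p * p) ⟨
    0ℚ + p * p      ≤⟨ ℚ.+-monoˡ-≤ (p * p) (ℚ.nonNegative⁻¹ 1ℚ) ⟩
    1ℚ + p * p      ∎
  where open ℚ.≤-Reasoning

-- Finite sums of rationals

sum-zero : ∀ {n} {f : Vector ℚ n} → (∀ i → f i ≡ 0ℚ) → sum f ≡ 0ℚ
sum-zero {n} f≡0 = trans (sum-cong-≗ f≡0) (sum-replicate-zero n)

sum-single : ∀ {n} (f : Vector ℚ n) i → (∀ j → j ≢ i → f j ≡ 0ℚ) → sum f ≡ f i
sum-single {suc n} f i others≡0 = trans (sum-remove f)
  (trans (cong (f i +_) (sum-zero (λ j → others≡0 (punchIn i j) (Fin.punchInᵢ≢i i j)))) (ℚ.+-identityʳ (f i)))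

sum-nonNeg : ∀ {n} {f : Vector ℚ n} → (∀ i → 0ℚ ≤ f i) → 0ℚ ≤ sum f
sum-nonNeg {zero}  0≤f = ℚ.≤-refl
sum-nonNeg {suc n} 0≤f = ℚ.+-mono-≤ (0≤f zero) (sum-nonNeg (λ i → 0≤f (suc i)))

term≤sum : ∀ {n} {f : Vector ℚ n} → (∀ i → 0ℚ ≤ f i) → ∀ i → f i ≤ sum f
term≤sum {suc n} {f} 0≤f zero = subst (_≤ sum f) (ℚ.+-identityʳ (f zero))
  (ℚ.+-monoʳ-≤ (f zero) (sum-nonNeg (λ i → 0≤f (suc i))))
term≤sum {suc n} {f} 0≤f (suc i) = subst (_≤ sum f) (ℚ.+-identityˡ (f (suc i)))
  (ℚ.+-mono-≤ (0≤f zero) (term≤sum (λ i → 0≤f (suc i)) i))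

sum-nonNeg≡0⇒term≡0 : ∀ {n} {f : Vector ℚ n} → (∀ i → 0ℚ ≤ f i) → sum f ≡ 0ℚ → ∀ i → f i ≡ 0ℚ
sum-nonNeg≡0⇒term≡0 0≤f Σf≡0 i = ℚ.≤-antisym (subst (_ ≤_) Σf≡0 (term≤sum 0≤f i)) (0≤f i)

∣sum∣≤sum : ∀ {n} {f g : Vector ℚ n} → (∀ i → ∣ f i ∣ ≤ g i) → ∣ sum f ∣ ≤ sum g
∣sum∣≤sum {zero}  f≤g = ℚ.≤-refl
∣sum∣≤sum {suc n} {f} f≤g = ℚ.≤-trans (ℚ.∣p+q∣≤∣p∣+∣q∣ (f zero) _)
  (ℚ.+-mono-≤ (f≤g zero) (∣sum∣≤sum (λ i → f≤g (suc i))))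

∣p*q∣≤r*∣q∣ : ∀ {p r} q → ∣ p ∣ ≤ r → ∣ p * q ∣ ≤ r * ∣ q ∣
∣p*q∣≤r*∣q∣ {p} q ∣p∣≤r = ℚ.≤-trans (ℚ.≤-reflexive (ℚ.∣p*q∣≡∣p∣*∣q∣ p q))
  (ℚ.*-monoʳ-≤-nonNeg ∣ q ∣ {{ℚ.∣-∣-nonNeg q}} ∣p∣≤r)

-- The zero vector works unless `s` vanishes; in that case the `i`-th unit vector produces the value
-- `c i`.
integer-shift-nonzero : ∀ {n} s (c : Vector ℚ n) i → c i ≢ 0ℚ →
  ∃ λ (t : Vector ℤ n) → s + sum (λ j → c j * ι (t j)) ≢ 0ℚ
integer-shift-nonzero s c zero c₀≢0 with s ℚ.≟ 0ℚ
... | no s≢0 = (λ _ → 0ℤ) , λ eq → s≢0 (trans (sym (trans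
        (cong (s +_) (sum-zero (λ j → ℚ.*-zeroʳ (c j)))) (ℚ.+-identityʳ s))) eq)
... | yes s≡0 = (1ℤ ∷ λ _ → 0ℤ) , λ eq → c₀≢0 (begin
    c zero                                               ≡⟨ solve 1 (λ x → x := con 0ℚ :+ (x :* con 1ℚ :+ con 0ℚ)) refl (c zero) ⟩
    0ℚ + (c zero * 1ℚ + 0ℚ)                              ≡⟨ cong₂ (λ x y → x + (c zero * 1ℚ + y)) (sym s≡0) (sym (sum-zero (λ j → ℚ.*-zeroʳ (c (suc j))))) ⟩
    s + (c zero * 1ℚ + sum (λ j → c (suc j) * ι 0ℤ))     ≡⟨ eq ⟩
    0ℚ                                                   ∎)
  where open ≡-Reasoning
integer-shift-nonzero s c (suc i) cᵢ≢0 with integer-shift-nonzero s (λ j → c (suc j)) i cᵢ≢0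
... | t , ≢0 = (0ℤ ∷ t) , λ eq → ≢0 (trans (cong (s +_) (sym (trans
        (cong (_+ sum (λ j → c (suc j) * ι (t j))) (ℚ.*-zeroʳ (c zero))) (ℚ.+-identityˡ _)))) eq)

-- Homogeneous linear systems

-- Eliminating with the pivot row k needs no division:
-- the rows aₖ₀ Aᵢ − aᵢ₀ Aₖ have vanishing first entry.
nontrivial-solution : ∀ {m n} → m ℕ.< n → (A : Vector (Vector ℚ n) m) →
  ∃₂ λ (c : Vector ℚ n) (j : Fin n) → c j ≢ 0ℚ × ∀ i → sum (λ j → A i j * c j) ≡ 0ℚ
nontrivial-solution {m} {suc n} m<n A with Fin.all? (λ i → A i zero ℚ.≟ 0ℚ)
... | yes A₀≡0 = (1ℚ ∷ λ _ → 0ℚ) , zero , ℚ.1≢0 , λ i → begin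
    A i zero * 1ℚ + sum (λ j → A i (suc j) * 0ℚ)  ≡⟨ cong₂ _+_ (trans (ℚ.*-identityʳ _) (A₀≡0 i)) (sum-zero (λ j → ℚ.*-zeroʳ (A i (suc j)))) ⟩
    0ℚ + 0ℚ                                       ≡⟨⟩
    0ℚ                                            ∎
  where open ≡-Reasoning
nontrivial-solution {zero} {suc n} m<n A | no A₀≢0 = contradiction (λ ()) A₀≢0
nontrivial-solution {suc m} {suc n} m<n A | no A₀≢0
  with Fin.¬∀⟶∃¬ (suc m) _ (λ i → A i zero ℚ.≟ 0ℚ) A₀≢0
... | k , Aₖ₀≢0
  with nontrivial-solution (ℕ.s<s⁻¹ m<n) (λ i j →
         A k zero * A (punchIn k i) (suc j) - A (punchIn k i) zero * A k (suc j))
-- Row `k` determines the first unknown as `- rest k` divided by the pivot. Scaling the whole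
-- solution by the pivot removes the division.
... | c , j , cⱼ≢0 , c-solves = (- rest k ∷ λ j → A k zero * c j) , suc j
    , (λ eq → cⱼ≢0 (p≢0∧p*q≡0⇒q≡0 Aₖ₀≢0 eq)) , solves
  where
  open ≡-Reasoning
  rest : Fin (suc m) → ℚ
  rest i = sum (λ j → A i (suc j) * c j)

  eliminated : ∀ i → A k zero * rest i - A i zero * rest k
                   ≡ sum (λ j → (A k zero * A i (suc j) - A i zero * A k (suc j)) * c j)
  eliminated i = begin
    A k zero * rest i - A i zero * rest k
      ≡⟨ solve 3 (λ x y z → x :- y :* z := x :+ (:- y) :* z) refl (A k zero * rest i) (A i zero) (rest k) ⟩
    A k zero * rest i + (- A i zero) * rest k
      ≡⟨ cong₂ _+_ (*-distribˡ-sum (A k zero) (λ j → A i (suc j) * c j)) (*-distribˡ-sum (- A i zero) (λ j → A k (suc j) * c j)) ⟩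
    sum (λ j → A k zero * (A i (suc j) * c j)) + sum (λ j → (- A i zero) * (A k (suc j) * c j))
      ≡⟨ ∑-distrib-+ (λ j → A k zero * (A i (suc j) * c j)) (λ j → (- A i zero) * (A k (suc j) * c j)) ⟨
    sum (λ j → A k zero * (A i (suc j) * c j) + (- A i zero) * (A k (suc j) * c j))
      ≡⟨ sum-cong-≗ (λ j → solve 5 (λ a b d e x → a :* (b :* x) :+ (:- d) :* (e :* x) := (a :* b :- d :* e) :* x)
           refl (A k zero) (A i (suc j)) (A i zero) (A k (suc j)) (c j)) ⟩
    sum (λ j → (A k zero * A i (suc j) - A i zero * A k (suc j)) * c j) ∎

  eliminated≡0 : ∀ i → A k zero * rest i - A i zero * rest k ≡ 0ℚ
  -- The smaller system omits row `k`, for which the expression is a difference of equal terms;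
  -- every other row is some `punchIn k`.
  eliminated≡0 i with k Fin.≟ i
  ... | yes refl = ℚ.+-inverseʳ (A k zero * rest k)
  ... | no k≢i = subst (λ i → A k zero * rest i - A i zero * rest k ≡ 0ℚ) (Fin.punchIn-punchOut k≢i)
                   (trans (eliminated (punchIn k (punchOut k≢i))) (c-solves (punchOut k≢i)))

  solves : ∀ i → A i zero * - rest k + sum (λ j → A i (suc j) * (A k zero * c j)) ≡ 0ℚ
  solves i = begin
    A i zero * - rest k + sum (λ j → A i (suc j) * (A k zero * c j))
      ≡⟨ cong (A i zero * - rest k +_) (trans
           (sum-cong-≗ (λ j → solve 3 (λ x y z → x :* (y :* z) := y :* (x :* z)) refl (A i (suc j)) (A k zero) (c j)))
           (sym (*-distribˡ-sum (A k zero) (λ j → A i (suc j) * c j)))) ⟩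
    A i zero * - rest k + A k zero * rest i
      ≡⟨ solve 4 (λ x y z w → x :* (:- y) :+ z :* w := z :* w :- x :* y) refl (A i zero) (rest k) (A k zero) (rest i) ⟩
    A k zero * rest i - A i zero * rest k
      ≡⟨ eliminated≡0 i ⟩
    0ℚ ∎

-- Finite enumerations

choices : ∀ {a} {A : Set a} {n} → Vector (List A) n → List (Vector A n)
choices {n = zero}  xs = (λ ()) List.∷ []
choices {n = suc n} xs = List.cartesianProductWith _∷_ (xs zero) (choices (λ i → xs (suc i)))

-- Without function extensionality a vector can only be found up to a
-- pointwise relation.
choices-complete : ∀ {a b r} {A : Set a} {B : Set b} (R : A → B → Set r) {n} {xs : Vector (List A) n}
  {y : Vector B n} → (∀ i → ∃ λ x → x List.∈ xs i × R x (y i)) →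
  ∃ λ x → x List.∈ choices xs × ∀ i → R (x i) (y i)
choices-complete R {zero}  pick = (λ ()) , here refl , λ ()
choices-complete R {suc n} pick with pick zero | choices-complete R (λ i → pick (suc i))
... | x , x∈ , Rx | x′ , x′∈ , Rx′ =
  (x ∷ x′) , ∈-cartesianProductWith⁺ _∷_ x∈ x′∈ , λ { zero → Rx ; (suc i) → Rx′ i }

module _ {c p a} {C : Set c} {P : Pred C p} {A : Set a}
         (P? : ∀ x → Dec (P x)) (f : ∀ x → P x → A) where

  collect : List C → List A
  collect [] = []
  collect (x List.∷ xs) with P? x
  ... | yes px = f x px List.∷ collect xs
  ... | no  _  = collect xs

  collect-complete : ∀ {x xs} → x List.∈ xs → P x → ∃ λ px → f x px List.∈ collect xs
  collect-complete {x} (here refl) px with P? x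
  ... | yes px′ = px′ , here refl
  ... | no ¬px = contradiction px ¬px
  collect-complete {x} {xs = y List.∷ _} (there x∈xs) px with P? y | collect-complete x∈xs px
  ... | yes _ | px′ , f∈ = px′ , there f∈
  ... | no  _ | px′ , f∈ = px′ , f∈

  -- The value of `f` may depend on the proof of `P x`, and `collect` records it at the proof that
  -- `P?` returns. Hence a cover must relate `y` to `f x px` for every `px`.
  finite-cover : ∀ {b r} {B : Set b} (R : B → A → Set r) (xs : List C) →
    (∀ y → ∃ λ x → x List.∈ xs × P x × (∀ px → R y (f x px))) →
    ∃ λ (as : List A) → ∀ y → ∃ λ j → R y (List.lookup as j)
  finite-cover R xs cover = collect xs , covered
    where
    covered : ∀ y → ∃ λ j → R y (List.lookup (collect xs) j)
    covered y with cover y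
    ... | x , x∈xs , px , R-all with collect-complete x∈xs px
    ... | px′ , f∈ = index f∈ , subst (R y) (lookup-index f∈) (R-all px′)

-- Linear functionals and coordinates

-- A common form for coordinates, pairings with a fixed vector and dot products, so that expansion
-- over `linComb` and vanishing on a span are proved once for all of them.
record LinearFunctional {m ℓm : Level} (V : ℚ-VectorSpace m ℓm) : Set (m ⊔ ℓm) where
  open Module V
  open LinearAlgebra V
  field
    _$_    : Carrierᴹ → ℚ
    $-cong : ∀ {u v} → u ≈ᴹ v → _$_ u ≡ _$_ v
    $-+    : ∀ u v → _$_ (u +ᴹ v) ≡ _$_ u + _$_ v
    $-*    : ∀ q u → _$_ (q *ₗ u) ≡ q * _$_ u

  $-0 : _$_ 0ᴹ ≡ 0ℚ
  $-0 = trans ($-cong (≈ᴹ-sym (*ₗ-zeroˡ 0ᴹ))) (trans ($-* 0ℚ 0ᴹ) (ℚ.*-zeroˡ (_$_ 0ᴹ)))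

  $-linComb : ∀ {d} (c : Vector ℚ d) x → _$_ (linComb c x) ≡ sum (λ i → c i * _$_ (x i))
  $-linComb {zero}  c x = $-0
  $-linComb {suc d} c x = trans ($-+ _ _) (cong₂ _+_ ($-* (c zero) (x zero)) ($-linComb (λ i → c (suc i)) (λ i → x (suc i))))

  vanishes-on-Span : ∀ {d} {x : Vector Carrierᴹ d} → (∀ i → _$_ (x i) ≡ 0ℚ) → ∀ {u} → Span x u → _$_ u ≡ 0ℚ
  vanishes-on-Span {x = x} fx≡0 (c , u≈) = trans ($-cong u≈) (trans ($-linComb c x)
    (sum-zero (λ i → trans (cong (c i *_) (fx≡0 i)) (ℚ.*-zeroʳ (c i)))))

module Coordinates {m ℓm} (V : ℚ-VectorSpace m ℓm) where
  open Module V
  open LinearAlgebra V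

  -- This identity is the evidence inside the proof that a span is closed under addition, taken at
  -- the two combinations themselves.
  linComb-+ : ∀ {d} b c (x : Vector Carrierᴹ d) → linComb (λ i → b i + c i) x ≈ᴹ linComb b x +ᴹ linComb c x
  linComb-+ b c x = ≈ᴹ-sym (proj₂ (Subspace.+-closed (span x) (b , ≈ᴹ-refl) (c , ≈ᴹ-refl)))

  linComb-* : ∀ {d} q c (x : Vector Carrierᴹ d) → linComb (λ i → q * c i) x ≈ᴹ q *ₗ linComb c x
  linComb-* q c x = ≈ᴹ-sym (proj₂ (Subspace.*-closed (span x) q (c , ≈ᴹ-refl)))

  linComb-cong : ∀ {d} {b c} (x : Vector Carrierᴹ d) → b ≗ c → linComb b x ≈ᴹ linComb c x
  linComb-cong x b≗c = Sum.sum-cong-≋ +ᴹ-commutativeMonoid (λ i → *ₗ-congʳ (b≗c i))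

  generator∈Span : ∀ {d} (x : Vector Carrierᴹ d) i → Span x (x i)
  generator∈Span x zero = (1ℚ ∷ λ _ → 0ℚ) , ≈ᴹ-sym (≈ᴹ-trans
    (+ᴹ-cong (*ₗ-identityˡ (x zero)) (≈ᴹ-sym (proj₂ (Subspace.0-closed (span (λ i → x (suc i)))))))
    (+ᴹ-identityʳ (x zero)))
  generator∈Span x (suc i) with generator∈Span (λ i → x (suc i)) i
  ... | c , xᵢ≈ = (0ℚ ∷ c) , ≈ᴹ-trans xᵢ≈ (≈ᴹ-sym (≈ᴹ-trans
    (+ᴹ-congʳ (*ₗ-zeroˡ (x zero))) (+ᴹ-identityˡ _)))

  module Basis {d} {b : Vector Carrierᴹ d} (basis : IsBasisOf U b) where

    coord : Carrierᴹ → Vector ℚ d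
    coord u = proj₁ (proj₁ (proj₂ basis) {u} tt)

    expansion : ∀ u → u ≈ᴹ linComb (coord u) b
    expansion u = proj₂ (proj₁ (proj₂ basis) {u} tt)

    coord-unique : ∀ {u} c → u ≈ᴹ linComb c b → coord u ≗ c
    coord-unique {u} c u≈ i = begin
      coord u i                          ≡⟨ solve 2 (λ x y → x := (x :+ (:- con 1ℚ) :* y) :+ y) refl (coord u i) (c i) ⟩
      coord u i + (- 1ℚ) * c i + c i     ≡⟨ cong (_+ c i) (proj₁ basis (λ i → coord u i + (- 1ℚ) * c i) difference≈0 i) ⟩
      0ℚ + c i                           ≡⟨ ℚ.+-identityˡ (c i) ⟩
      c i                                ∎
      where
      open ≡-Reasoning
      difference≈0 : linComb (λ i → coord u i + (- 1ℚ) * c i) b ≈ᴹ 0ᴹ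
      difference≈0 = ≈ᴹ-trans (linComb-+ (coord u) (λ i → (- 1ℚ) * c i) b)
        (≈ᴹ-trans (+ᴹ-cong (≈ᴹ-trans (≈ᴹ-sym (expansion u)) u≈) (linComb-* (- 1ℚ) c b))
        (≈ᴹ-trans (+ᴹ-congʳ (≈ᴹ-sym (*ₗ-identityˡ (linComb c b))))
        (≈ᴹ-trans (≈ᴹ-sym (*ₗ-distribʳ (linComb c b) 1ℚ (- 1ℚ))) (*ₗ-zeroˡ (linComb c b)))))

    coordinate : Fin d → LinearFunctional V
    coordinate j = record
      { _$_    = λ u → coord u j
      ; $-cong = λ {u} {v} u≈v → coord-unique (coord v) (≈ᴹ-trans u≈v (expansion v)) j
      ; $-+    = λ u v → coord-unique (λ j → coord u j + coord v j)
                   (≈ᴹ-trans (+ᴹ-cong (expansion u) (expansion v)) (≈ᴹ-sym (linComb-+ (coord u) (coord v) b))) j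
      ; $-*    = λ q u → coord-unique (λ j → q * coord u j)
                   (≈ᴹ-trans (*ₗ-congˡ (expansion u)) (≈ᴹ-sym (linComb-* q (coord u) b))) j
      }

    coord-injective : ∀ {u v} → coord u ≗ coord v → u ≈ᴹ v
    coord-injective {u} {v} eq = ≈ᴹ-trans (expansion u) (≈ᴹ-trans (linComb-cong b eq) (≈ᴹ-sym (expansion v)))

    -- Reduces an identity between vectors to identities in ℚ, where the ring solver applies.
    functionals-separate : ∀ {u v} → (∀ (f : LinearFunctional V) → LinearFunctional._$_ f u ≡ LinearFunctional._$_ f v) → u ≈ᴹ v
    functionals-separate eq = coord-injective (λ j → eq (coordinate j))

-- The kernel of a matrix of corank one

dot : ∀ {n} → Vector ℚ n → LinearFunctional (ℚ^ n)
dot c = record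
  { _$_    = λ u → sum (λ j → u j * c j)
  ; $-cong = λ u≈v → sum-cong-≗ (λ j → cong (_* c j) (u≈v j))
  ; $-+    = λ u v → trans (sum-cong-≗ (λ j → ℚ.*-distribʳ-+ (c j) (u j) (v j)))
               (∑-distrib-+ (λ j → u j * c j) (λ j → v j * c j))
  ; $-*    = λ q u → trans (sum-cong-≗ (λ j → ℚ.*-assoc q (u j) (c j)))
               (sym (*-distribˡ-sum q (λ j → u j * c j)))
  }

entry : ∀ {n} → Fin n → LinearFunctional (ℚ^ n)
entry j = record { _$_ = λ u → u j ; $-cong = λ u≈v → u≈v j ; $-+ = λ _ _ → refl ; $-* = λ _ _ → refl }

Kernel : ∀ {n} → Matrix n → Pred (Vector ℚ n) _
Kernel β c = ∀ i → sum (λ j → β i j * c j) ≡ 0ℚ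

module _ {n r} (β : Matrix n) (rank : HasRank β r) where
  open LinearAlgebra (ℚ^ n)
  open Coordinates (ℚ^ n) using (generator∈Span)

  private
    R = proj₁ rank
    R-independent = proj₁ (proj₂ rank)

    R-vanishes : ∀ {c} → Kernel β c → ∀ k → sum (λ j → R k j * c j) ≡ 0ℚ
    R-vanishes {c} βc≡0 k =
      LinearFunctional.vanishes-on-Span (dot c) βc≡0 (proj₂ (proj₂ (proj₂ rank)) (generator∈Span R k))

  -- It is enough to solve the `r` equations given by a basis `R` of the row space, and these are
  -- fewer than the unknowns.
  kernel-nontrivial : r ℕ.< n → ∃₂ λ c j → c j ≢ 0ℚ × Kernel β c
  kernel-nontrivial r<n with nontrivial-solution r<n R
  ... | c , j , cⱼ≢0 , Rc≡0 = c , j , cⱼ≢0 , λ i →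
    LinearFunctional.vanishes-on-Span (dot c) Rc≡0 (proj₁ (proj₂ (proj₂ rank)) (generator∈Span β i))

  -- A relation between two kernel vectors and a basis of the row space splits,
  -- because the kernel is orthogonal to the row space and the dot product is anisotropic.
  kernel-dependent : n ℕ.< 2 ℕ.+ r → ∀ {c d} → Kernel β c → Kernel β d →
    ∃₂ λ x y → ¬ (x ≡ 0ℚ × y ≡ 0ℚ) × ∀ j → x * c j + y * d j ≡ 0ℚ
  kernel-dependent n<2+r {c} {d} βc≡0 βd≡0
    -- One equation for each of the `n` positions, in the 2 + r unknown coefficients of `c`, `d` and
    -- the rows of `R`.
    with nontrivial-solution n<2+r (λ j → c j ∷ d j ∷ λ k → R k j)
  ... | a , k , aₖ≢0 , relation = a zero , a (suc zero) , nontrivial k aₖ≢0 , t≡0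
    where
    open ≡-Reasoning
    open LinearFunctional
    x = a zero
    y = a (suc zero)
    z : Vector ℚ r
    z k = a (suc (suc k))
    t : Vector ℚ n
    t j = x * c j + y * d j

    t+zR≡0 : ∀ j → t j + linComb z R j ≡ 0ℚ
    t+zR≡0 j = begin
      t j + linComb z R j                                ≡⟨ cong (t j +_) (LinearFunctional.$-linComb (entry j) z R) ⟩
      t j + sum (λ k → z k * R k j)                      ≡⟨ cong (t j +_) (sum-cong-≗ (λ k → ℚ.*-comm (z k) (R k j))) ⟩
      t j + sum (λ k → R k j * z k)                      ≡⟨ solve 5 (λ x c y d s → x :* c :+ y :* d :+ s := c :* x :+ (d :* y :+ s)) refl x (c j) y (d j) _ ⟩
      c j * x + (d j * y + sum (λ k → R k j * z k))      ≡⟨ relation j ⟩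
      0ℚ                                                 ∎

    βt≡0 : Kernel β t
    βt≡0 i = begin
      sum (λ j → β i j * t j)
        ≡⟨ sum-cong-≗ (λ j → ℚ.*-comm (β i j) (t j)) ⟩
      dot (β i) $ t
        ≡⟨ trans ($-+ (dot (β i)) (λ j → x * c j) (λ j → y * d j)) (cong₂ _+_ ($-* (dot (β i)) x c) ($-* (dot (β i)) y d)) ⟩
      x * (dot (β i) $ c) + y * (dot (β i) $ d)
        ≡⟨ cong₂ (λ s u → x * s + y * u)
             (trans (sum-cong-≗ (λ j → ℚ.*-comm (c j) (β i j))) (βc≡0 i))
             (trans (sum-cong-≗ (λ j → ℚ.*-comm (d j) (β i j))) (βd≡0 i)) ⟩
      x * 0ℚ + y * 0ℚ
        ≡⟨ solve 2 (λ x y → x :* con 0ℚ :+ y :* con 0ℚ := con 0ℚ) refl x y ⟩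
      0ℚ ∎

    t·t≡0 : dot t $ t ≡ 0ℚ
    t·t≡0 = begin
      dot t $ t                              ≡⟨ ℚ.+-identityʳ (dot t $ t) ⟨
      (dot t $ t) + 0ℚ                       ≡⟨ cong ((dot t $ t) +_) (vanishes-on-Span (dot t) (R-vanishes βt≡0) (z , λ _ → refl)) ⟨
      (dot t $ t) + (dot t $ linComb z R)    ≡⟨ $-+ (dot t) t (linComb z R) ⟨
      dot t $ (λ j → t j + linComb z R j)    ≡⟨ $-cong (dot t) t+zR≡0 ⟩
      dot t $ (λ _ → 0ℚ)                     ≡⟨ $-0 (dot t) ⟩
      0ℚ                                     ∎

    t≡0 : ∀ j → t j ≡ 0ℚ
    t≡0 j = p*p≡0⇒p≡0 (t j) (sum-nonNeg≡0⇒term≡0 (λ j → 0≤p*p (t j)) t·t≡0 j)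

    nontrivial : ∀ k → a k ≢ 0ℚ → ¬ (x ≡ 0ℚ × y ≡ 0ℚ)
    nontrivial zero          x≢0 (x≡0 , _) = x≢0 x≡0
    nontrivial (suc zero)    y≢0 (_ , y≡0) = y≢0 y≡0
    -- This case cannot occur: once `t` vanishes, what is left is a relation among the independent
    -- rows of `R`.
    nontrivial (suc (suc k)) z≢0 _         = z≢0 (R-independent z zR≡0 k)
      where
      zR≡0 : ∀ j → linComb z R j ≡ 0ℚ
      zR≡0 j = begin
        linComb z R j          ≡⟨ ℚ.+-identityˡ (linComb z R j) ⟨
        0ℚ + linComb z R j     ≡⟨ cong (_+ linComb z R j) (t≡0 j) ⟨
        t j + linComb z R j    ≡⟨ t+zR≡0 j ⟩
        0ℚ                     ∎

-- Quadratic spaces of signature (p, 1)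

module Form {m ℓm} {V : ℚ-VectorSpace m ℓm} (B : SymmetricBilinearForm V) where
  open Module V
  open LinearAlgebra V
  open QuadraticSpace B
  open SymmetricBilinearForm B public
  open LinearFunctional

  pairing : Carrierᴹ → LinearFunctional V
  pairing w = record
    { _$_    = λ u → ⟨ u , w ⟩
    ; $-cong = λ u≈v → ⟨⟩-cong u≈v ≈ᴹ-refl
    ; $-+    = λ u v → ⟨⟩-+ u v w
    ; $-*    = λ q u → ⟨⟩-* q u w
    }

  -- For isotropic `w` the form descends to the quotient of w^⊥ by ℚw; all cross terms vanish. Gram
  -- matrices therefore depend only on classes modulo ℚw.
  ⟨⟩-shift : ∀ {w u v} s t → Isotropic w → ⟨ u , w ⟩ ≡ 0ℚ → ⟨ v , w ⟩ ≡ 0ℚ →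
    ⟨ u +ᴹ s *ₗ w , v +ᴹ t *ₗ w ⟩ ≡ ⟨ u , v ⟩
  ⟨⟩-shift {w} {u} {v} s t ww≡0 uw≡0 vw≡0 = begin
    ⟨ u +ᴹ s *ₗ w , v +ᴹ t *ₗ w ⟩
      ≡⟨ trans (⟨⟩-+ u (s *ₗ w) _) (cong (⟨ u , v +ᴹ t *ₗ w ⟩ +_) (⟨⟩-* s w _)) ⟩
    ⟨ u , v +ᴹ t *ₗ w ⟩ + s * ⟨ w , v +ᴹ t *ₗ w ⟩
      ≡⟨ cong₂ (λ x y → x + s * y) (expand u) (expand w) ⟩
    ⟨ u , v ⟩ + t * ⟨ u , w ⟩ + s * (⟨ w , v ⟩ + t * ⟨ w , w ⟩)
      ≡⟨ cong₂ (λ x y → ⟨ u , v ⟩ + t * x + s * y) uw≡0 (cong₂ (λ x y → x + t * y) (trans (⟨⟩-sym w v) vw≡0) ww≡0) ⟩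
    ⟨ u , v ⟩ + t * 0ℚ + s * (0ℚ + t * 0ℚ)
      ≡⟨ solve 3 (λ x s t → x :+ t :* con 0ℚ :+ s :* (con 0ℚ :+ t :* con 0ℚ) := x) refl ⟨ u , v ⟩ s t ⟩
    ⟨ u , v ⟩ ∎
    where
    open ≡-Reasoning
    expand : ∀ x → ⟨ x , v +ᴹ t *ₗ w ⟩ ≡ ⟨ x , v ⟩ + t * ⟨ x , w ⟩
    expand x = trans (⟨⟩-sym x _) (trans (⟨⟩-+ v (t *ₗ w) x)
      (cong₂ _+_ (⟨⟩-sym v x) (trans (⟨⟩-* t w x) (cong (t *_) (⟨⟩-sym w x)))))

  norm-orthogonal : ∀ {d} (c : Vector ℚ d) (e : Vector Carrierᴹ d) → (∀ i j → i ≢ j → ⟨ e i , e j ⟩ ≡ 0ℚ) →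
    ⟨ linComb c e , linComb c e ⟩ ≡ sum (λ i → c i * c i * ⟨ e i , e i ⟩)
  norm-orthogonal c e orthogonal = trans ($-linComb (pairing (linComb c e)) c e) (sum-cong-≗ λ i → begin
    c i * ⟨ e i , linComb c e ⟩            ≡⟨ cong (c i *_) (trans (⟨⟩-sym (e i) _) ($-linComb (pairing (e i)) c e)) ⟩
    c i * sum (λ j → c j * ⟨ e j , e i ⟩)  ≡⟨ cong (c i *_) (sum-single (λ j → c j * ⟨ e j , e i ⟩) i
                                               (λ j j≢i → trans (cong (c j *_) (orthogonal j i j≢i)) (ℚ.*-zeroʳ (c j)))) ⟩
    c i * (c i * ⟨ e i , e i ⟩)            ≡⟨ ℚ.*-assoc (c i) (c i) ⟨ e i , e i ⟩ ⟨
    c i * c i * ⟨ e i , e i ⟩              ∎)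
    where open ≡-Reasoning

  -- Translates between orthogonality of a combination to all `X i` and membership of its
  -- coefficient vector in the kernel of `β`.
  ½⟨linComb,⟩ : ∀ {n} {β : Matrix n} {X : Vector Carrierᴹ n} → (∀ i j → ½ * ⟨ X i , X j ⟩ ≡ β i j) →
    ∀ c i → ½ * ⟨ linComb c X , X i ⟩ ≡ sum (λ j → β i j * c j)
  ½⟨linComb,⟩ {β = β} {X} gram c i = begin
    ½ * ⟨ linComb c X , X i ⟩                   ≡⟨ cong (½ *_) ($-linComb (pairing (X i)) c X) ⟩
    ½ * sum (λ j → c j * ⟨ X j , X i ⟩)         ≡⟨ *-distribˡ-sum ½ (λ j → c j * ⟨ X j , X i ⟩) ⟩
    sum (λ j → ½ * (c j * ⟨ X j , X i ⟩))       ≡⟨ sum-cong-≗ (λ j → trans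
                                                     (solve 3 (λ h x y → h :* (x :* y) := h :* y :* x) refl ½ (c j) ⟨ X j , X i ⟩)
                                                     (cong (_* c j) (trans (cong (½ *_) (⟨⟩-sym (X j) (X i))) (gram i j)))) ⟩
    sum (λ j → β i j * c j)                     ∎
    where open ≡-Reasoning

module Lorentzian {m ℓm} {V : ℚ-VectorSpace m ℓm} (B : SymmetricBilinearForm V)
                  (p : ℕ) (signature : QuadraticSpace.HasSignature B p 1) where
  open Module V
  open LinearAlgebra V
  open QuadraticSpace B
  open Form B
  open Coordinates V
  open LinearFunctional

  e : Vector Carrierᴹ (p ℕ.+ 1)
  e = proj₁ signature

  module E = Basis (proj₁ (proj₂ signature))

  last : Fin (p ℕ.+ 1)
  last = p ↑ʳ zero

  private
    orthogonal : ∀ i j → i ≢ j → ⟨ e i , e j ⟩ ≡ 0ℚ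
    orthogonal = proj₁ (proj₂ (proj₂ signature))

    positive-or-last : ∀ i → 0ℚ < ⟨ e i , e i ⟩ ⊎ i ≡ last
    positive-or-last i with Fin.splitAt p i in eq
    ... | inj₁ i′ = inj₁ (subst (λ i → 0ℚ < ⟨ e i , e i ⟩) (Fin.splitAt⁻¹-↑ˡ eq) (proj₁ (proj₂ (proj₂ (proj₂ signature))) i′))
    ... | inj₂ zero = inj₂ (sym (Fin.splitAt⁻¹-↑ʳ eq))

    norm : ∀ z → ⟨ z , z ⟩ ≡ sum (λ i → E.coord z i * E.coord z i * ⟨ e i , e i ⟩)
    norm z = trans (⟨⟩-cong (E.expansion z) (E.expansion z)) (norm-orthogonal (E.coord z) e orthogonal)

    norm-term≥0 : ∀ {z} → E.coord z last ≡ 0ℚ → ∀ i → 0ℚ ≤ E.coord z i * E.coord z i * ⟨ e i , e i ⟩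
    norm-term≥0 {z} z₀≡0 i with positive-or-last i
    ... | inj₁ 0<eᵢ = 0≤p*q (0≤p*p (E.coord z i)) (ℚ.<⇒≤ 0<eᵢ)
    ... | inj₂ refl rewrite z₀≡0 = ℚ.≤-reflexive (sym (ℚ.*-zeroˡ ⟨ e i , e i ⟩))

  -- On the hyperplane of vanishing last coordinate the norm is a sum of squares with positive
  -- weights, so each square is zero if the sum is.
  definite : ∀ {z} → E.coord z last ≡ 0ℚ → Isotropic z → z ≈ᴹ 0ᴹ
  definite {z} z₀≡0 zz≡0 = E.coord-injective (λ i → trans (coordᵢ≡0 i) (sym ($-0 (E.coordinate i))))
    where
    coordᵢ≡0 : ∀ i → E.coord z i ≡ 0ℚ
    coordᵢ≡0 i with positive-or-last i
    ... | inj₂ refl = z₀≡0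
    ... | inj₁ 0<eᵢ with p*q≡0⇒p≡0∨q≡0 (E.coord z i * E.coord z i) ⟨ e i , e i ⟩
                          (sum-nonNeg≡0⇒term≡0 (norm-term≥0 z₀≡0) (trans (sym (norm z)) zz≡0) i)
    ...   | inj₁ zᵢ²≡0 = p*p≡0⇒p≡0 (E.coord z i) zᵢ²≡0
    ...   | inj₂ eᵢ≡0 = contradiction (sym eᵢ≡0) (ℚ.<⇒≢ 0<eᵢ)

  -- With a = ⟨e i, e i⟩ > 0, the single term x²a is at most the whole norm `N`, which gives |x| ≤ 1
  -- + x² ≤ 1 + N/a. The bound is chosen before `z`.
  norm-bounds-coord : ∀ N i → ∃ λ M → ∀ z → E.coord z last ≡ 0ℚ → ⟨ z , z ⟩ ≡ N → ∣ E.coord z i ∣ ≤ M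
  norm-bounds-coord N i with positive-or-last i
  ... | inj₂ refl = 0ℚ , λ z z₀≡0 _ → ℚ.≤-reflexive (cong ∣_∣ z₀≡0)
  ... | inj₁ 0<eᵢ = 1ℚ + N * 1/ a , λ z z₀≡0 zz≡N → let x = E.coord z i in begin
      ∣ x ∣                     ≤⟨ ∣p∣≤1+p*p x ⟩
      1ℚ + x * x                ≡⟨ cong (1ℚ +_) (trans (ℚ.*-assoc (x * x) a (1/ a)) (trans (cong (x * x *_) (ℚ.*-inverseʳ a)) (ℚ.*-identityʳ (x * x)))) ⟨
      1ℚ + x * x * a * 1/ a     ≤⟨ ℚ.+-monoʳ-≤ 1ℚ (ℚ.*-monoʳ-≤-nonNeg (1/ a)
                                     (ℚ.≤-trans (term≤sum (norm-term≥0 z₀≡0) i) (ℚ.≤-reflexive (trans (sym (norm z)) zz≡N)))) ⟩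
      1ℚ + N * 1/ a             ∎
    where
    open ℚ.≤-Reasoning
    a = ⟨ e i , e i ⟩
    instance
      a>0 = ℚ.positive 0<eᵢ
      a≢0 = ℚ.pos⇒nonZero a
      1/a≥0 = ℚ.pos⇒nonNeg (1/ a) {{ℚ.1/pos⇒pos a}}

  module NullVector {w : Carrierᴹ} (w≉0 : ¬ (w ≈ᴹ 0ᴹ)) (ww≡0 : Isotropic w) where

    -- A nonzero isotropic vector cannot lie in the positive definite hyperplane.
    w₀≢0 : E.coord w last ≢ 0ℚ
    w₀≢0 w₀≡0 = w≉0 (definite w₀≡0 ww≡0)

    private instance
      w₀-nonZero = ℚ.≢-nonZero w₀≢0

    ratio : Carrierᴹ → ℚ
    ratio y = E.coord y last * 1/ E.coord w last

    -- The representative of y modulo ℚw on which the form, restricted to w^⊥, is visibly positive.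
    reduced : Carrierᴹ → Carrierᴹ
    reduced y = y +ᴹ (- ratio y) *ₗ w

    $-reduced : ∀ (f : LinearFunctional V) y → f $ reduced y ≡ f $ y + (- ratio y) * (f $ w)
    $-reduced f y = trans ($-+ f y _) (cong (f $ y +_) ($-* f (- ratio y) w))

    reduced-last : ∀ y → E.coord (reduced y) last ≡ 0ℚ
    reduced-last y = begin
      E.coord (reduced y) last            ≡⟨ $-reduced (E.coordinate last) y ⟩
      y₀ + - (y₀ * 1/ w₀) * w₀            ≡⟨ solve 3 (λ y i w → y :+ (:- (y :* i)) :* w := y :- y :* (i :* w)) refl y₀ (1/ w₀) w₀ ⟩
      y₀ - y₀ * (1/ w₀ * w₀)              ≡⟨ cong (λ x → y₀ - y₀ * x) (ℚ.*-inverseˡ w₀) ⟩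
      y₀ - y₀ * 1ℚ                        ≡⟨ solve 1 (λ y → y :- y :* con 1ℚ := con 0ℚ) refl y₀ ⟩
      0ℚ                                  ∎
      where
      open ≡-Reasoning
      y₀ = E.coord y last
      w₀ = E.coord w last

    reduced-norm : ∀ {y} → ⟨ y , w ⟩ ≡ 0ℚ → ⟨ reduced y , reduced y ⟩ ≡ ⟨ y , y ⟩
    reduced-norm {y} yw≡0 = ⟨⟩-shift (- ratio y) (- ratio y) ww≡0 yw≡0 yw≡0

    -- The reduced vector is again isotropic and lies in the definite hyperplane, so it is zero. In
    -- other words, signature (p, 1) leaves no room for an isotropic plane.
    isotropic⇒multiple : ∀ {u} → ⟨ u , w ⟩ ≡ 0ℚ → Isotropic u → u ≈ᴹ ratio u *ₗ w
    isotropic⇒multiple {u} uw≡0 uu≡0 = E.functionals-separate λ f → begin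
      f $ u                                                    ≡⟨ solve 3 (λ x r y → x := (x :+ (:- r) :* y) :+ r :* y) refl (f $ u) (ratio u) (f $ w) ⟩
      (f $ u) + (- ratio u) * (f $ w) + ratio u * (f $ w)      ≡⟨ cong (_+ ratio u * (f $ w)) ($-reduced f u) ⟨
      (f $ reduced u) + ratio u * (f $ w)                      ≡⟨ cong (_+ ratio u * (f $ w)) (trans ($-cong f reduced≈0) ($-0 f)) ⟩
      0ℚ + ratio u * (f $ w)                                   ≡⟨ ℚ.+-identityˡ (ratio u * (f $ w)) ⟩
      ratio u * (f $ w)                                        ≡⟨ $-* f (ratio u) w ⟨
      f $ (ratio u *ₗ w)                                       ∎
      where
      open ≡-Reasoning
      reduced≈0 : reduced u ≈ᴹ 0ᴹ
      reduced≈0 = definite (reduced-last u) (trans (reduced-norm uw≡0) uu≡0)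

-- Finiteness of the set of spans

module Subspaces {m ℓm} (V : ℚ-VectorSpace m ℓm) where
  open Module V
  open LinearAlgebra V

  Span⊆ : ∀ {s d} {x : Vector Carrierᴹ d} (S : Subspace s) → (∀ i → x i ∈ member S) → Span x ⊆ member S
  Span⊆ {x = x} S x∈S (c , u≈) = Subspace.resp-≈ S (≈ᴹ-sym u≈) (linComb∈ x x∈S c)
    where
    linComb∈ : ∀ {d} (x : Vector Carrierᴹ d) → (∀ i → x i ∈ member S) → ∀ c → linComb c x ∈ member S
    linComb∈ {zero}  x x∈S c = Subspace.0-closed S
    linComb∈ {suc d} x x∈S c = Subspace.+-closed S (Subspace.*-closed S (c zero) (x∈S zero))
      (linComb∈ (x ∘ suc) (x∈S ∘ suc) (c ∘ suc))

-- One coordinate of g - kw = (y - rw) + (r - k)w - h with y = g + h. For r the ratio of y and k an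
-- integer near it, each summand on the right is bounded.
split-multiple : ∀ g k w h r → g + - k * w ≡ ((g + h) + - r * w) + (r - k) * w - h
split-multiple = solve 5 (λ g k w h r → g :+ (:- k) :* w := ((g :+ h) :+ (:- r) :* w) :+ (r :- k) :* w :- h) refl

cancel-multiple : ∀ g h k w → g + h ≡ ((g + - k * w) + h) + k * w
cancel-multiple = solve 4 (λ g h k w → g :+ h := ((g :+ (:- k) :* w) :+ h) :+ k :* w) refl

-- Lattice vectors modulo an isotropic lattice vector

module Lattice {m ℓm} {V : ℚ-VectorSpace m ℓm} (B : SymmetricBilinearForm V)
               (p : ℕ) (signature : QuadraticSpace.HasSignature B p 1)
               (b : Vector (Module.Carrierᴹ V) (p ℕ.+ 1)) (basis : LinearAlgebra.IsBasisOf V U b)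
               where
  open Module V
  open LinearAlgebra V
  open QuadraticSpace B
  open Form B
  open Coordinates V
  open LinearFunctional
  open Lorentzian B p signature
  module L = Basis basis

  latticeVector : Vector ℤ (p ℕ.+ 1) → Carrierᴹ
  latticeVector g = linComb (ι ∘ g) b

  coord-latticeVector : ∀ g j → L.coord (latticeVector g) j ≡ ι (g j)
  coord-latticeVector g = L.coord-unique (ι ∘ g) ≈ᴹ-refl

  module Representatives (W : Vector ℤ (p ℕ.+ 1)) (w≉0 : ¬ (latticeVector W ≈ᴹ 0ᴹ))
                         (ww≡0 : Isotropic (latticeVector W)) where
    open NullVector w≉0 ww≡0

    w : Carrierᴹ
    w = latticeVector W

    -- Subtracting ⌊ratio y⌋ w leaves the reduced vector, whose coordinates are
    -- bounded by its norm, plus a multiple of w by a number in [0, 1].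
    finite-mod-w : ∀ h N → ∃ λ (gs : List (Vector ℤ (p ℕ.+ 1))) →
      ∀ y g₀ → y ≈ᴹ latticeVector g₀ +ᴹ h → ⟨ y , w ⟩ ≡ 0ℚ → ⟨ y , y ⟩ ≡ N →
      ∃₂ λ g k → g List.∈ gs × y ≈ᴹ (latticeVector g +ᴹ h) +ᴹ ι k *ₗ w
    finite-mod-w h N = choices (λ j → proj₁ (bounded-integers (K j))) , complete
      where
      M : Vector ℚ (p ℕ.+ 1)
      M i = proj₁ (norm-bounds-coord N i)

      -- The three summands bound the contributions of the reduced vector, of the remainder
      -- `ratio y - ι k`, at most 1 in absolute value, and of the translation by `h`.
      K : Vector ℚ (p ℕ.+ 1)
      K j = sum (λ i → M i * ∣ L.coord (e i) j ∣) + 1ℚ * ∣ L.coord w j ∣ + ∣ L.coord h j ∣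

      complete : ∀ y g₀ → y ≈ᴹ latticeVector g₀ +ᴹ h → ⟨ y , w ⟩ ≡ 0ℚ → ⟨ y , y ⟩ ≡ N →
        ∃₂ λ g k → g List.∈ choices (λ j → proj₁ (bounded-integers (K j)))
                 × y ≈ᴹ (latticeVector g +ᴹ h) +ᴹ ι k *ₗ w
      complete y g₀ y≈ yw≡0 yy≡N = g , k , proj₁ (proj₂ found) , L.coord-injective y≡
        where
        k = proj₁ (near-integer (ratio y))
        r = ratio y - ι k
        ζ = E.coord (reduced y)

        coord-reduced : ∀ j → L.coord (reduced y) j ≡ sum (λ i → ζ i * L.coord (e i) j)
        coord-reduced j = trans ($-cong (L.coordinate j) (E.expansion (reduced y))) ($-linComb (L.coordinate j) ζ e)

        shifted : ∀ j → ι (g₀ j ℤ.+ ℤ.- k ℤ.* W j)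
                      ≡ sum (λ i → ζ i * L.coord (e i) j) + r * L.coord w j - L.coord h j
        shifted j = begin
          ι (g₀ j ℤ.+ ℤ.- k ℤ.* W j)
            ≡⟨ trans (ι-+ (g₀ j) (ℤ.- k ℤ.* W j)) (cong (ι (g₀ j) +_) (trans (ι-* (ℤ.- k) (W j)) (cong (_* ι (W j)) (ι-neg k)))) ⟩
          ι (g₀ j) + - ι k * ι (W j)
            ≡⟨ cong₂ (λ x y → x + - ι k * y) (coord-latticeVector g₀ j) (coord-latticeVector W j) ⟨
          L.coord (latticeVector g₀) j + - ι k * L.coord w j
            ≡⟨ split-multiple (L.coord (latticeVector g₀) j) (ι k) (L.coord w j) (L.coord h j) (ratio y) ⟩
          ((L.coord (latticeVector g₀) j + L.coord h j) + - ratio y * L.coord w j) + r * L.coord w j - L.coord h j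
            ≡⟨ cong (λ x → (x + - ratio y * L.coord w j) + r * L.coord w j - L.coord h j)
                 (trans ($-cong (L.coordinate j) y≈) ($-+ (L.coordinate j) (latticeVector g₀) h)) ⟨
          (L.coord y j + - ratio y * L.coord w j) + r * L.coord w j - L.coord h j
            ≡⟨ cong (λ x → x + r * L.coord w j - L.coord h j) (trans (sym ($-reduced (L.coordinate j) y)) (coord-reduced j)) ⟩
          sum (λ i → ζ i * L.coord (e i) j) + r * L.coord w j - L.coord h j ∎
          where open ≡-Reasoning

        bounded : ∀ j → ∣ ι (g₀ j ℤ.+ ℤ.- k ℤ.* W j) ∣ ≤ K j
        bounded j = begin
          ∣ ι (g₀ j ℤ.+ ℤ.- k ℤ.* W j) ∣
            ≡⟨ cong ∣_∣ (shifted j) ⟩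
          ∣ sum (λ i → ζ i * L.coord (e i) j) + r * L.coord w j - L.coord h j ∣
            ≤⟨ ℚ.∣p-q∣≤∣p∣+∣q∣ (sum (λ i → ζ i * L.coord (e i) j) + r * L.coord w j) (L.coord h j) ⟩
          ∣ sum (λ i → ζ i * L.coord (e i) j) + r * L.coord w j ∣ + ∣ L.coord h j ∣
            ≤⟨ ℚ.+-monoˡ-≤ ∣ L.coord h j ∣ (ℚ.≤-trans (ℚ.∣p+q∣≤∣p∣+∣q∣ (sum (λ i → ζ i * L.coord (e i) j)) (r * L.coord w j))
                 (ℚ.+-mono-≤
                   (∣sum∣≤sum {f = λ i → ζ i * L.coord (e i) j} (λ i → ∣p*q∣≤r*∣q∣ (L.coord (e i) j)
                     (proj₂ (norm-bounds-coord N i) (reduced y) (reduced-last y) (trans (reduced-norm yw≡0) yy≡N))))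
                   (∣p*q∣≤r*∣q∣ (L.coord w j) (proj₂ (near-integer (ratio y)))))) ⟩
          K j ∎
          where open ℚ.≤-Reasoning

        found : ∃ λ g → g List.∈ choices (λ j → proj₁ (bounded-integers (K j))) × ∀ j → g j ≡ g₀ j ℤ.+ ℤ.- k ℤ.* W j
        found = choices-complete _≡_ (λ j → _ , proj₂ (bounded-integers (K j)) _ (bounded j) , refl)

        g = proj₁ found
        g≗ = proj₂ (proj₂ found)

        y≡ : ∀ j → L.coord y j ≡ L.coord ((latticeVector g +ᴹ h) +ᴹ ι k *ₗ w) j
        y≡ j = begin
          L.coord y j
            ≡⟨ trans ($-cong (L.coordinate j) y≈) ($-+ (L.coordinate j) (latticeVector g₀) h) ⟩
          L.coord (latticeVector g₀) j + L.coord h j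
            ≡⟨ cong (_+ L.coord h j) (coord-latticeVector g₀ j) ⟩
          ι (g₀ j) + L.coord h j
            ≡⟨ cancel-multiple (ι (g₀ j)) (L.coord h j) (ι k) (ι (W j)) ⟩
          ((ι (g₀ j) + - ι k * ι (W j)) + L.coord h j) + ι k * ι (W j)
            ≡⟨ cong₂ (λ x y → (x + L.coord h j) + ι k * y)
                 (sym (trans (cong ι (g≗ j)) (trans (ι-+ (g₀ j) (ℤ.- k ℤ.* W j)) (cong (ι (g₀ j) +_) (trans (ι-* (ℤ.- k) (W j)) (cong (_* ι (W j)) (ι-neg k)))))))
                 (sym (coord-latticeVector W j)) ⟩
          (ι (g j) + L.coord h j) + ι k * L.coord w j
            ≡⟨ cong (λ x → (x + L.coord h j) + ι k * L.coord w j) (coord-latticeVector g j) ⟨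
          (L.coord (latticeVector g) j + L.coord h j) + ι k * L.coord w j
            ≡⟨ trans ($-+ (L.coordinate j) (latticeVector g +ᴹ h) (ι k *ₗ w))
                 (cong₂ _+_ ($-+ (L.coordinate j) (latticeVector g) h) ($-* (L.coordinate j) (ι k) w)) ⟨
          L.coord ((latticeVector g +ᴹ h) +ᴹ ι k *ₗ w) j ∎
          where open ≡-Reasoning

module Finiteness {m ℓm} {V : ℚ-VectorSpace m ℓm} (B : SymmetricBilinearForm V)
               (p : ℕ) (signature : QuadraticSpace.HasSignature B p 1)
               (b : Vector (Module.Carrierᴹ V) (p ℕ.+ 1)) (basis : LinearAlgebra.IsBasisOf V U b)
               where
  open Module V
  open LinearAlgebra V
  open QuadraticSpace B
  open Form B
  open Coordinates V
  open Subspaces V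
  open LinearFunctional
  open Lorentzian B p signature
  open Lattice B p signature b basis

  linComb-shift : ∀ {d} (c q : Vector ℚ d) (x : Vector Carrierᴹ d) w →
    linComb c (λ i → x i +ᴹ q i *ₗ w) ≈ᴹ linComb c x +ᴹ sum (λ i → c i * q i) *ₗ w
  linComb-shift c q x w = E.functionals-separate λ f → begin
    f $ linComb c (λ i → x i +ᴹ q i *ₗ w)
      ≡⟨ $-linComb f c (λ i → x i +ᴹ q i *ₗ w) ⟩
    sum (λ i → c i * (f $ (x i +ᴹ q i *ₗ w)))
      ≡⟨ sum-cong-≗ (λ i → trans (cong (c i *_) (trans ($-+ f (x i) (q i *ₗ w)) (cong (f $ x i +_) ($-* f (q i) w))))
           (solve 4 (λ c x q w → c :* (x :+ q :* w) := c :* x :+ c :* q :* w) refl (c i) (f $ x i) (q i) (f $ w))) ⟩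
    sum (λ i → c i * (f $ x i) + c i * q i * (f $ w))
      ≡⟨ ∑-distrib-+ (λ i → c i * (f $ x i)) (λ i → c i * q i * (f $ w)) ⟩
    sum (λ i → c i * (f $ x i)) + sum (λ i → c i * q i * (f $ w))
      ≡⟨ cong₂ _+_ ($-linComb f c x) (*-distribʳ-sum (f $ w) (λ i → c i * q i)) ⟨
    (f $ linComb c x) + sum (λ i → c i * q i) * (f $ w)
      ≡⟨ trans ($-+ f (linComb c x) _) (cong (f $ linComb c x +_) ($-* f _ w)) ⟨
    f $ (linComb c x +ᴹ sum (λ i → c i * q i) *ₗ w) ∎
    where open ≡-Reasoning

  shift-difference : ∀ {u v a w} s t → u ≈ᴹ a +ᴹ s *ₗ w → v ≈ᴹ a +ᴹ t *ₗ w → u ≈ᴹ v +ᴹ (s - t) *ₗ w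
  shift-difference {u} {v} {a} {w} s t u≈ v≈ = E.functionals-separate λ f → begin
    f $ u                                                ≡⟨ trans ($-cong f u≈) ($-shift f a s) ⟩
    (f $ a) + s * (f $ w)                                ≡⟨ solve 4 (λ a s t w → a :+ s :* w := (a :+ t :* w) :+ (s :- t) :* w) refl (f $ a) s t (f $ w) ⟩
    ((f $ a) + t * (f $ w)) + (s - t) * (f $ w)          ≡⟨ cong (_+ (s - t) * (f $ w)) (trans ($-cong f v≈) ($-shift f a t)) ⟨
    (f $ v) + (s - t) * (f $ w)                          ≡⟨ $-shift f v (s - t) ⟨
    f $ (v +ᴹ (s - t) *ₗ w)                              ∎
    where
    open ≡-Reasoning
    $-shift : ∀ f x q → f $ (x +ᴹ q *ₗ w) ≡ f $ x + q * (f $ w)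
    $-shift f x q = trans ($-+ f x (q *ₗ w)) (cong (f $ x +_) ($-* f q w))

  -- Multiples of a vector already in the span can be absorbed. If both spans contain `w`, the lemma
  -- applies in both directions.
  Span-shift : ∀ {d} {x y : Vector Carrierᴹ d} {w} (q : Vector ℚ d) → w ∈ Span y →
    (∀ i → x i ≈ᴹ y i +ᴹ q i *ₗ w) → Span x ⊆ Span y
  Span-shift {y = y} q w∈ x≈ = Span⊆ (span y) λ i → Subspace.resp-≈ (span y) (≈ᴹ-sym (x≈ i))
    (Subspace.+-closed (span y) (generator∈Span y i) (Subspace.*-closed (span y) (q i) w∈))

  -- Tuples with radical `ℓ`, where `ℓ` is generated by a lattice vector

  module OnLine {n lv} (β : Matrix (suc n)) (rank : HasRank β n) (ℓ : Subspace lv)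
    (W : Vector ℤ (p ℕ.+ 1)) (w≉0 : ¬ (latticeVector W ≈ᴹ 0ᴹ)) (w∈ℓ : latticeVector W ∈ member ℓ)
    (ww≡0 : Isotropic (latticeVector W))
    (ℓ⊆ℚw : ∀ {u} → u ∈ member ℓ → ∃ λ q → u ≈ᴹ q *ₗ latticeVector W) where

    open NullVector w≉0 ww≡0
    open Representatives W w≉0 ww≡0

    module _ {X : Vector Carrierᴹ (suc n)} (X∈Ω : X ∈ Ω β ℓ) where

      Ω⇒w∈Span : w ∈ Span X
      Ω⇒w∈Span = proj₁ (proj₂ (proj₂ X∈Ω) w∈ℓ)

      Ω⇒⊥w : ∀ i → ⟨ X i , w ⟩ ≡ 0ℚ
      Ω⇒⊥w i = trans (⟨⟩-sym (X i) w) (proj₂ (proj₂ (proj₂ X∈Ω) w∈ℓ) (X i) (generator∈Span X i))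

      Ω⇒Span⊆ℓ⊥ : Span X ⊆ ℓ ⊥
      Ω⇒Span⊆ℓ⊥ {u} u∈ v v∈ℓ = trans (⟨⟩-sym u v) (proj₂ (proj₂ (proj₂ X∈Ω) v∈ℓ) u u∈)

      -- The coefficients of a vanishing combination and those of w are both in the
      -- kernel of β, hence proportional; as w ≉ 0 the former vanish.
      Ω⇒independent : LinearlyIndependent X
      Ω⇒independent c cX≈0 i = p≢0∧p*q≡0⇒q≡0 (λ x≡0 → nontrivial (x≡0 , y≡0)) (begin
          x * c i                 ≡⟨ solve 2 (λ a b → a := a :+ con 0ℚ :* b) refl (x * c i) (d i) ⟩
          x * c i + 0ℚ * d i      ≡⟨ cong (λ y → x * c i + y * d i) y≡0 ⟨
          x * c i + y * d i       ≡⟨ xc+yd≡0 i ⟩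
          0ℚ                      ∎)
        where
        open ≡-Reasoning
        kernel : ∀ {u} c → u ≈ᴹ linComb c X → (∀ i → ⟨ u , X i ⟩ ≡ 0ℚ) → Kernel β c
        kernel c u≈ u⊥X i = trans (sym (½⟨linComb,⟩ (proj₁ X∈Ω) c i))
          (cong (½ *_) (trans (⟨⟩-cong (≈ᴹ-sym u≈) ≈ᴹ-refl) (u⊥X i)))
        c∈Kernel : Kernel β c
        c∈Kernel = kernel c (≈ᴹ-sym cX≈0) (λ i → $-0 (pairing (X i)))
        d = proj₁ Ω⇒w∈Span
        d∈Kernel : Kernel β d
        d∈Kernel = kernel d (proj₂ Ω⇒w∈Span) (λ i → trans (⟨⟩-sym w (X i)) (Ω⇒⊥w i))
        dependence : ∃₂ λ x y → ¬ (x ≡ 0ℚ × y ≡ 0ℚ) × ∀ j → x * c j + y * d j ≡ 0ℚ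
        dependence = kernel-dependent β rank (ℕ.n<1+n (suc n)) {c} {d} c∈Kernel d∈Kernel
        x = proj₁ dependence
        y = proj₁ (proj₂ dependence)
        nontrivial = proj₁ (proj₂ (proj₂ dependence))
        xc+yd≡0 = proj₂ (proj₂ (proj₂ dependence))
        -- The last coordinate does not vanish on `w`, so applying it to the relation isolates `y`.
        f = E.coordinate last
        yw₀≡0 : y * (f $ w) ≡ 0ℚ
        yw₀≡0 = begin
          y * (f $ w)                                      ≡⟨ solve 2 (λ x y → y := x :* con 0ℚ :+ y) refl x (y * (f $ w)) ⟩
          x * 0ℚ + y * (f $ w)                             ≡⟨ cong₂ (λ s t → x * s + y * t) (trans ($-cong f cX≈0) ($-0 f)) ($-cong f (≈ᴹ-sym (proj₂ Ω⇒w∈Span))) ⟨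
          x * (f $ linComb c X) + y * (f $ linComb d X)    ≡⟨ cong₂ _+_ ($-* f x (linComb c X)) ($-* f y (linComb d X)) ⟨
          f $ (x *ₗ linComb c X) + f $ (y *ₗ linComb d X)  ≡⟨ $-+ f (x *ₗ linComb c X) (y *ₗ linComb d X) ⟨
          f $ (x *ₗ linComb c X +ᴹ y *ₗ linComb d X)       ≡⟨ $-cong f (≈ᴹ-trans (linComb-+ (λ i → x * c i) (λ i → y * d i) X)
                                                                (+ᴹ-cong (linComb-* x c X) (linComb-* y d X))) ⟨
          f $ linComb (λ i → x * c i + y * d i) X          ≡⟨ $-linComb f (λ i → x * c i + y * d i) X ⟩
          sum (λ i → (x * c i + y * d i) * (f $ X i))      ≡⟨ sum-zero (λ i → trans (cong (_* (f $ X i)) (xc+yd≡0 i)) (ℚ.*-zeroˡ (f $ X i))) ⟩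
          0ℚ                                               ∎
        y≡0 : y ≡ 0ℚ
        y≡0 = p≢0∧p*q≡0⇒q≡0 w₀≢0 (trans (ℚ.*-comm (f $ w) y) yw₀≡0)

    -- Replaces the condition on the radical, which quantifies over all vectors, by finitely many
    -- equations in ℚ. These are decidable and unaffected by shifts along `w`.
    Admissible : Vector Carrierᴹ (suc n) → Set
    Admissible X = (∀ i j → ½ * ⟨ X i , X j ⟩ ≡ β i j) × (∀ i → ⟨ X i , w ⟩ ≡ 0ℚ)

    admissible? : ∀ X → Dec (Admissible X)
    admissible? X = Fin.all? (λ i → Fin.all? λ j → ½ * ⟨ X i , X j ⟩ ℚ.≟ β i j) ×-dec Fin.all? (λ i → ⟨ X i , w ⟩ ℚ.≟ 0ℚ)

    -- For c in the kernel of β, the combination u = Σ cᵢ Xᵢ is orthogonal to w and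
    -- isotropic, so u = s w; shifting one Xᵢ with cᵢ ≠ 0 by w makes s nonzero.
    admissible⇒Ω : ∀ {X} → Admissible X → ∃ λ (t : Vector ℤ (suc n)) → (λ i → X i +ᴹ ι (t i) *ₗ w) ∈ Ω β ℓ
    admissible⇒Ω {X} (gram , X⊥w) = t , (λ i j → trans (cong (½ *_) (⟨⟩-shift (ι (t i)) (ι (t j)) ww≡0 (X⊥w i) (X⊥w j))) (gram i j))
                      , Radical⊆ℓ , ℓ⊆Radical
      where
      open ≡-Reasoning
      c = proj₁ (kernel-nontrivial β rank (ℕ.n<1+n n))
      βc≡0 = proj₂ (proj₂ (proj₂ (kernel-nontrivial β rank (ℕ.n<1+n n))))
      shift : ∃ λ (t : Vector ℤ (suc n)) → ratio (linComb c X) + sum (λ j → c j * ι (t j)) ≢ 0ℚ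
      shift = integer-shift-nonzero (ratio (linComb c X)) c _ (proj₁ (proj₂ (proj₂ (kernel-nontrivial β rank (ℕ.n<1+n n)))))
      t = proj₁ shift
      s≢0 = proj₂ shift
      Y : Vector Carrierᴹ (suc n)
      Y i = X i +ᴹ ι (t i) *ₗ w
      u = linComb c X
      s = ratio u + sum (λ j → c j * ι (t j))

      uX≡0 : ∀ i → ⟨ X i , u ⟩ ≡ 0ℚ
      uX≡0 i = trans (⟨⟩-sym (X i) u) (p≢0∧p*q≡0⇒q≡0 {½} (λ ()) (trans (½⟨linComb,⟩ gram c i) (βc≡0 i)))

      u≈ : u ≈ᴹ ratio u *ₗ w
      u≈ = isotropic⇒multiple (vanishes-on-Span (pairing w) X⊥w (c , ≈ᴹ-refl))
             (vanishes-on-Span (pairing u) uX≡0 (c , ≈ᴹ-refl))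

      cY≈sw : linComb c Y ≈ᴹ s *ₗ w
      cY≈sw = ≈ᴹ-trans (linComb-shift c (ι ∘ t) X w) (≈ᴹ-trans (+ᴹ-congʳ u≈)
        (≈ᴹ-sym (*ₗ-distribʳ w (ratio u) (sum (λ j → c j * ι (t j))))))

      w∈ : w ∈ Span Y
      w∈ = Subspace.resp-≈ (span Y)
        (≈ᴹ-trans (≈ᴹ-sym (*ₗ-assoc (1/ s) s w)) (≈ᴹ-trans (*ₗ-congʳ (ℚ.*-inverseˡ s)) (*ₗ-identityˡ w)))
        (Subspace.*-closed (span Y) (1/ s) (c , ≈ᴹ-sym cY≈sw))
        where instance _ = ℚ.≢-nonZero s≢0

      Y⊥w : ∀ i → ⟨ Y i , w ⟩ ≡ 0ℚ
      Y⊥w i = begin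
        ⟨ X i +ᴹ ι (t i) *ₗ w , w ⟩       ≡⟨ trans (⟨⟩-+ (X i) _ w) (cong (⟨ X i , w ⟩ +_) (⟨⟩-* (ι (t i)) w w)) ⟩
        ⟨ X i , w ⟩ + ι (t i) * ⟨ w , w ⟩ ≡⟨ cong₂ (λ x y → x + ι (t i) * y) (X⊥w i) ww≡0 ⟩
        0ℚ + ι (t i) * 0ℚ                 ≡⟨ solve 1 (λ x → con 0ℚ :+ x :* con 0ℚ := con 0ℚ) refl (ι (t i)) ⟩
        0ℚ                                ∎

      Span⊥w : ∀ {v} → v ∈ Span Y → ⟨ v , w ⟩ ≡ 0ℚ
      Span⊥w = vanishes-on-Span (pairing w) Y⊥w

      -- A vector of the radical is orthogonal both to `w` and to itself, hence a multiple of `w`.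
      Radical⊆ℓ : Radical (span Y) ⊆ member ℓ
      Radical⊆ℓ {v} (v∈ , v⊥) = Subspace.resp-≈ ℓ (≈ᴹ-sym (isotropic⇒multiple (Span⊥w v∈) (v⊥ v v∈)))
        (Subspace.*-closed ℓ (ratio v) w∈ℓ)

      ℓ⊆Radical : member ℓ ⊆ Radical (span Y)
      ℓ⊆Radical {v} v∈ℓ = Subspace.resp-≈ (span Y) (≈ᴹ-sym v≈) (Subspace.*-closed (span Y) q w∈) , λ x x∈ → begin
        ⟨ v , x ⟩        ≡⟨ ⟨⟩-cong v≈ ≈ᴹ-refl ⟩
        ⟨ q *ₗ w , x ⟩   ≡⟨ trans (⟨⟩-* q w x) (cong (q *_) (trans (⟨⟩-sym w x) (Span⊥w x∈))) ⟩
        q * 0ℚ           ≡⟨ ℚ.*-zeroʳ q ⟩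
        0ℚ               ∎
        where
        q = proj₁ (ℓ⊆ℚw v∈ℓ)
        v≈ = proj₂ (ℓ⊆ℚw v∈ℓ)

    module _ {X Z : Vector Carrierᴹ (suc n)} (X∈Ω : X ∈ Ω β ℓ) (k : Vector ℚ (suc n))
             (X≈ : ∀ i → X i ≈ᴹ Z i +ᴹ k i *ₗ w) where

      -- `X` is orthogonal to `w` because `w` lies in its radical. Passing to the representative `Z`
      -- preserves this and the Gram matrix.
      Ω⇒admissible : Admissible Z
      Ω⇒admissible = (λ i j → trans (cong (½ *_) (trans
            (sym (⟨⟩-shift (k i) (k j) ww≡0 (Z⊥w i) (Z⊥w j)))
            (⟨⟩-cong (≈ᴹ-sym (X≈ i)) (≈ᴹ-sym (X≈ j)))))
          (proj₁ X∈Ω i j)) , Z⊥w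
        where
        open ≡-Reasoning
        Z⊥w : ∀ i → ⟨ Z i , w ⟩ ≡ 0ℚ
        Z⊥w i = begin
          ⟨ Z i , w ⟩                    ≡⟨ solve 2 (λ x y → x := x :+ y :* con 0ℚ) refl ⟨ Z i , w ⟩ (k i) ⟩
          ⟨ Z i , w ⟩ + k i * 0ℚ         ≡⟨ cong (λ x → ⟨ Z i , w ⟩ + k i * x) ww≡0 ⟨
          ⟨ Z i , w ⟩ + k i * ⟨ w , w ⟩  ≡⟨ trans (⟨⟩-+ (Z i) (k i *ₗ w) w) (cong (⟨ Z i , w ⟩ +_) (⟨⟩-* (k i) w w)) ⟨
          ⟨ Z i +ᴹ k i *ₗ w , w ⟩        ≡⟨ ⟨⟩-cong (X≈ i) ≈ᴹ-refl ⟨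
          ⟨ X i , w ⟩                    ≡⟨ Ω⇒⊥w X∈Ω i ⟩
          0ℚ                             ∎

      -- Both spans contain the radical and with it `w`, and the two tuples differ by multiples of
      -- `w`. So any solution in the class of `X` has the span of `X`.
      Span-unchanged : (t : Vector ℚ (suc n)) → (λ i → Z i +ᴹ t i *ₗ w) ∈ Ω β ℓ → Span X ≐ Span (λ i → Z i +ᴹ t i *ₗ w)
      Span-unchanged t Y∈Ω =
          Span-shift (λ i → k i - t i) (Ω⇒w∈Span Y∈Ω) (λ i → shift-difference (k i) (t i) (X≈ i) ≈ᴹ-refl)
        , Span-shift (λ i → t i - k i) (Ω⇒w∈Span X∈Ω) (λ i → shift-difference (t i) (k i) ≈ᴹ-refl (X≈ i))

    -- From finitely many classes to finitely many spans

    module _ {r} {L : Pred Carrierᴹ r} (L≐ℤSpan : L ≐ ℤSpan b) (h : Vector Carrierᴹ (suc n)) where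

      latticePoint : Vector (Vector ℤ (p ℕ.+ 1)) (suc n) → Vector Carrierᴹ (suc n)
      latticePoint G i = latticeVector (G i) +ᴹ h i

      -- Here `ℓ` needs a generator in the lattice and the shifts need to be integral: the
      -- correction then stays within `L`.
      shifted∈Coset : ∀ G (t : Vector ℤ (suc n)) → (λ i → latticePoint G i +ᴹ ι (t i) *ₗ w) ∈ Coset L h
      shifted∈Coset G t i = latticeVector (G i) +ᴹ ι (t i) *ₗ w
        , proj₂ L≐ℤSpan ((λ j → G i j ℤ.+ t i ℤ.* W j) , ≈ᴹ-sym (≈ᴹ-trans
            (linComb-cong b (λ j → trans (ι-+ (G i j) (t i ℤ.* W j)) (cong (ι (G i j) +_) (ι-* (t i) (W j)))))
            (≈ᴹ-trans (linComb-+ (ι ∘ G i) (λ j → ι (t i) * ι (W j)) b)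
              (+ᴹ-congˡ (linComb-* (ι (t i)) (ι ∘ W) b)))))
        , ≈ᴹ-trans (+ᴹ-assoc _ _ _) (≈ᴹ-trans (+ᴹ-congˡ (+ᴹ-comm (h i) _)) (≈ᴹ-sym (+ᴹ-assoc _ _ _)))

      Solution : Set _
      Solution = ∃ λ X → X ∈ Ω β ℓ ∩ Coset L h

      Represents : Vector Carrierᴹ (suc n) → Vector (Vector ℤ (p ℕ.+ 1)) (suc n) → Set _
      Represents X G = ∃ λ (k : Vector ℚ (suc n)) → ∀ i → X i ≈ᴹ latticePoint G i +ᴹ k i *ₗ w

      candidate? : ∀ G → Dec (Admissible (latticePoint G))
      candidate? G = admissible? (latticePoint G)

      solve-candidate : ∀ G → Admissible (latticePoint G) → Solution
      solve-candidate G admissible =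
        (λ i → latticePoint G i +ᴹ ι (t i) *ₗ w) , proj₂ (admissible⇒Ω admissible) , shifted∈Coset G t
        where t = proj₁ (admissible⇒Ω admissible)

      SameSpan : Solution → Solution → Set _
      SameSpan X Y = Span (proj₁ X) ≐ Span (proj₁ Y)

      -- The solution manufactured from the class of `X` need not be `X`, but it has the same span,
      -- and only spans are compared.
      candidates⇒solutions : (Gs : List (Vector (Vector ℤ (p ℕ.+ 1)) (suc n))) →
        (∀ (X : Solution) → ∃ λ G → G List.∈ Gs × Represents (proj₁ X) G) →
        ∃ λ (Xs : List Solution) → ∀ (X : Solution) → ∃ λ j → SameSpan X (List.lookup Xs j)
      candidates⇒solutions Gs represented = finite-cover candidate? solve-candidate SameSpan Gs cover
        where
        cover : ∀ X → ∃ λ G → G List.∈ Gs × Admissible (latticePoint G) × (∀ admissible → SameSpan X (solve-candidate G admissible))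
        cover X = proj₁ (represented X) , proj₁ (proj₂ (represented X))
            , Ω⇒admissible (proj₁ (proj₂ X)) k X≈
            , λ admissible → Span-unchanged (proj₁ (proj₂ X)) k X≈ (ι ∘ proj₁ (admissible⇒Ω admissible)) (proj₂ (admissible⇒Ω admissible))
          where
          k = proj₁ (proj₂ (proj₂ (represented X)))
          X≈ = proj₂ (proj₂ (proj₂ (represented X)))

      finitely-many-spans : ∃ λ (Xs : List Solution) → ∀ (X : Solution) → ∃ λ j → SameSpan X (List.lookup Xs j)
      finitely-many-spans = candidates⇒solutions (choices (λ i → proj₁ (representatives i))) represented
        where
        -- The diagonal of the Gram condition fixes the norm of the entry `X i` as 2 β i i.
        representatives = λ i → finite-mod-w (h i) ((1ℚ + 1ℚ) * β i i)

        represented : ∀ (X : Solution) → ∃ λ G → G List.∈ choices (λ i → proj₁ (representatives i)) × Represents (proj₁ X) G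
        represented (X , X∈Ω , X∈Coset) =
          proj₁ chosen , proj₁ (proj₂ chosen) , (λ i → ι (proj₁ (proj₂ (proj₂ chosen) i))) , λ i → proj₂ (proj₂ (proj₂ chosen) i)
          where
          pick : ∀ i → ∃ λ g → g List.∈ proj₁ (representatives i)
                             × ∃ λ k → X i ≈ᴹ (latticeVector g +ᴹ h i) +ᴹ ι k *ₗ w
          pick i = proj₁ found , proj₁ (proj₂ (proj₂ found)) , proj₁ (proj₂ found) , proj₂ (proj₂ (proj₂ found))
            where
            x∈ℤSpan = proj₁ L≐ℤSpan (proj₁ (proj₂ (X∈Coset i)))
            found = proj₂ (representatives i) (X i) (proj₁ x∈ℤSpan)
              (≈ᴹ-trans (proj₂ (proj₂ (X∈Coset i))) (+ᴹ-congʳ (proj₂ x∈ℤSpan))) (Ω⇒⊥w X∈Ω i)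
              (trans (solve 1 (λ x → x := (con 1ℚ :+ con 1ℚ) :* (con ½ :* x)) refl ⟨ X i , X i ⟩)
                (cong ((1ℚ + 1ℚ) *_) (proj₁ X∈Ω i i)))
          chosen : ∃ λ G → G List.∈ choices (λ i → proj₁ (representatives i))
                         × ∀ i → ∃ λ k → X i ≈ᴹ latticePoint G i +ᴹ ι k *ₗ w
          -- The vector to be matched is that of the indices themselves, which lets the relation
          -- mention both `X i` and `h i`.
          chosen = choices-complete (λ g i → ∃ λ k → X i ≈ᴹ (latticeVector g +ᴹ h i) +ᴹ ι k *ₗ w) {y = λ i → i} pick

module _ {m ℓm} (V : ℚ-VectorSpace m ℓm) where
  open Module V
  open LinearAlgebra V
  open Coordinates V

  -- A rational generator is multiplied by a common denominator `D` of its coordinates in the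
  -- lattice basis; as `D` is nonzero the multiple still generates the line.
  integral-generator : ∀ {s d} {b : Vector Carrierᴹ d} → IsBasisOf U b → (ℓ : Subspace s) → HasDimension (member ℓ) 1 →
    ∃ λ (W : Vector ℤ d) → let w = linComb (ι ∘ W) b in
      ¬ (w ≈ᴹ 0ᴹ) × w ∈ member ℓ × (∀ {u} → u ∈ member ℓ → ∃ λ q → u ≈ᴹ q *ₗ w)
  integral-generator {b = b} basis ℓ (x , independent , ℓ⊆ , ⊆ℓ)
    with common-denominator (Basis.coord basis (x zero))
  ... | D , C , D≢0 , Dc≡C = C
      , (λ w≈0 → D≢0 (independent (λ _ → ι D) (≈ᴹ-trans (+ᴹ-identityʳ _) (≈ᴹ-trans (≈ᴹ-sym w≈) w≈0)) zero))
      , ⊆ℓ ((λ _ → ι D) , ≈ᴹ-trans w≈ (≈ᴹ-sym (+ᴹ-identityʳ _)))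
      , multiple
    where
    open Basis basis
    instance _ = ℚ.≢-nonZero D≢0
    w = linComb (ι ∘ C) b

    w≈ : w ≈ᴹ ι D *ₗ x zero
    w≈ = ≈ᴹ-sym (≈ᴹ-trans (*ₗ-congˡ (expansion (x zero))) (≈ᴹ-trans
      (≈ᴹ-sym (linComb-* (ι D) (coord (x zero)) b)) (linComb-cong b Dc≡C)))

    multiple : ∀ {u} → u ∈ member ℓ → ∃ λ q → u ≈ᴹ q *ₗ w
    multiple {u} u∈ with ℓ⊆ u∈
    ... | c , u≈ = c zero * 1/ ι D , ≈ᴹ-trans u≈ (≈ᴹ-trans (+ᴹ-identityʳ _) (≈ᴹ-sym (≈ᴹ-trans (*ₗ-congˡ w≈)
      (≈ᴹ-trans (≈ᴹ-sym (*ₗ-assoc (c zero * 1/ ι D) (ι D) (x zero)))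
        (*ₗ-congʳ (trans (ℚ.*-assoc (c zero) (1/ ι D) (ι D))
          (trans (cong (c zero *_) (ℚ.*-inverseˡ (ι D))) (ℚ.*-identityʳ (c zero)))))))))

lemma3p2 : ∀ {m ℓm s t : Level} (p n : ℕ)
  (V : ℚ-VectorSpace m ℓm) (B : SymmetricBilinearForm V) →
  let open Module V
      open LinearAlgebra V
      open QuadraticSpace B
  in
  HasDimension U (p ℕ.+ 1) →
  NonDegenerate →
  HasSignature p 1 →
  (∃ λ v → ¬ (v ≈ᴹ 0ᴹ) × Isotropic v) →
  (L : Pred Carrierᴹ s) → IsFullLattice (p ℕ.+ 1) L → L ⊆ L ♯ →
  1 ℕ.≤ n → n ℕ.≤ p →
  (h : Vector Carrierᴹ n) → (∀ i → h i ∈ L ♯) →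
  (β : Matrix n) → IsSymmetric β → PositiveSemidefinite β → HasRank β (n ∸ 1) →
  (ℓ : Subspace t) → IsIsotropicLine ℓ →
  ∃ λ a → ∃ λ (Us : Vector (Subspace ℓm) a) →
    (∀ i → HasDimension (member (Us i)) n × member (Us i) ⊆ ℓ ⊥)
    × SetOf U Us ≐ SetOf (Ω β ℓ ∩ Coset L h) span
lemma3p2 p (suc n) V B _ _ signature _ L (b , basis , L≐ℤSpan) _ _ _ h _ β _ _ rank ℓ (dimension , isotropic) =
  conclude (finitely-many-spans L≐ℤSpan h)
  where
  open LinearAlgebra V
  open QuadraticSpace B
  open Finiteness B p signature b basis
  generator = integral-generator V basis ℓ dimension
  w∈ℓ = proj₁ (proj₂ (proj₂ generator))
  open OnLine β rank ℓ (proj₁ generator) (proj₁ (proj₂ generator)) w∈ℓ (isotropic w∈ℓ) (proj₂ (proj₂ (proj₂ generator)))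

  conclude : (∃ λ (Xs : List (Solution L≐ℤSpan h)) →
               ∀ X → ∃ λ j → SameSpan L≐ℤSpan h X (List.lookup Xs j)) →
    ∃ λ a → ∃ λ (Us : Vector (Subspace _) a) →
      (∀ i → HasDimension (member (Us i)) (suc n) × member (Us i) ⊆ ℓ ⊥)
      × SetOf U Us ≐ SetOf (Ω β ℓ ∩ Coset L h) span
  -- The subspaces are the spans of the listed solutions. Several solutions may share a span, which
  -- is harmless because only the sets of subspaces are compared.
  conclude (Xs , complete) = List.length Xs , (λ i → span (X i))
    , (λ i → (X i , Ω⇒independent (X∈Ω i) , (λ u∈ → u∈) , (λ u∈ → u∈)) , Ω⇒Span⊆ℓ⊥ (X∈Ω i))
    , (λ { (i , _ , S≐) → X i , proj₂ (List.lookup Xs i) , S≐ })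
    , (λ { (Y , Y∈ , S⊆ , ⊆S) → let i , Y⊆ , ⊆Y = complete (Y , Y∈) in
           i , tt , (λ u∈ → Y⊆ (S⊆ u∈)) , (λ u∈ → ⊆S (⊆Y u∈)) })
    where
    X = λ i → proj₁ (List.lookup Xs i)
    X∈Ω : ∀ i → X i ∈ Ω β ℓ
    X∈Ω i = proj₁ (proj₂ (List.lookup Xs i))
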